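{- Let $r\ge 2$ be an integer, and let $n_2,n_3,\dots,n_r,m,w$ be nonnegative integers with $n_2$ even and $n_2\ge 2$. Suppose that for each $k$ with $2\le k\le r$ there are $n_k$ $k$-tuples (families consisting of one husband and his $k-1$ wife/wives), and that in addition there are $m$ single men and $w$ single women. The number of ways to seat all these persons around a circular table such that (1) all members of each family sit together, (2) no man sits adjacent to a woman except his own wife/wives, and (3) every husband having more than one wife is surrounded by his wives, is $$\prod_{k=3}^{r}\bigl((k-2)\cdot (k-1)!\bigr)^{n_k}\cdot \frac{n_2!}{\left(\frac{n_2}{2}\right)!}\cdot \frac{\left(\frac{n_2}{2}+m-1\right)!}{\left(\frac{n_2}{2}-1\right)!}\cdot \left(\sum_{k=3}^{r} n_k+\frac{n_2}{2}+w-1\right)!.$$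
   Context: All persons are distinguishable. Every person belongs to exactly one family ($k$-tuple for some $2\le k\le r$) or is a single man or a single woman. The circular table has exactly as many seats as there are persons, and each person occupies one seat. Two seatings are regarded as the same if and only if one is obtained from the other by a rotation of the table; opposite orientations (mirror images) are counted as different. "Adjacent" means occupying cyclically neighbouring seats. Condition (1), "all members of a family sit together", means that the members of each family occupy a set of cyclically consecutive seats. Condition (2) means that whenever a man and a woman are adjacent, the woman is a wife of that man (so in particular single men are never adjacent to a woman, and single women are never adjacent to a man). Condition (3), "surrounded by his wives", means that both neighbours of such a husband are his own wives. Empty products equal $1$ and empty sums equal $0$. -}

module Defs where

open import Data.Nat
open import Data.Nat.Properties using (+-assoc; +-comm; *-suc)
open import Data.Nat.DivMod
open import Data.Nat.ListAction using (sum; product)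
open import Data.Fin.Base using (Fin; toℕ)
open import Data.Fin.Properties using (toℕ-injective; toℕ-fromℕ<; toℕ<n; nonZeroIndex)
open import Data.List.Base using (applyUpTo)
open import Data.Product.Base using (∃-syntax; _×_; _,_)
open import Data.Sum.Base using (_⊎_)
open import Function.Bundles using (Inverse; _↔_; _⇔_)
open import Level using (0ℓ)
open import Relation.Binary.Bundles using (Setoid)
open import Relation.Binary.Structures using (IsEquivalence)
open import Relation.Binary.PropositionalEquality
open import Relation.Unary using (Pred)

-- Sum and product of f k over a ≤ k ≤ b; these are 0 and 1 when b < a.

Σ[_⋯_] : ℕ → ℕ → (ℕ → ℕ) → ℕ
Σ[ a ⋯ b ] f = sum (applyUpTo (λ i → f (a + i)) (suc b ∸ a))

Π[_⋯_] : ℕ → ℕ → (ℕ → ℕ) → ℕ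
Π[ a ⋯ b ] f = product (applyUpTo (λ i → f (a + i)) (suc b ∸ a))

HasCardinality : Setoid 0ℓ 0ℓ → ℕ → Set
HasCardinality S c = Inverse S (setoid (Fin c))

-- Seats of a round table with N seats are Fin N; i ⊕ d is the seat d places
-- after i, counting cyclically.

infixl 6 _⊕_

_⊕_ : ∀ {N} → Fin N → ℕ → Fin N
_⊕_ {N} i d = ((toℕ i + d) mod N) {{nonZeroIndex i}}

Adjacent : ∀ {N} → Fin N → Fin N → Set
Adjacent i j = (j ≡ i ⊕ 1) ⊎ (i ≡ j ⊕ 1)

Consecutive : ∀ {N} → Pred (Fin N) 0ℓ → Set
Consecutive P = ∃[ a ] ∃[ l ] (∀ x → P x ⇔ (∃[ j ] j < l × x ≡ a ⊕ j))

-- Two seatings are related when a rotation of the table carries one to the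
-- other; reflections are not included.

RotationOf : ∀ {N} {A : Set} → (s t : Fin N → A) → Set
RotationOf s t = ∃[ d ] (∀ i → t i ≡ s (i ⊕ d))

toℕ-⊕ : ∀ {N} (i : Fin N) d .{{_ : NonZero N}} → toℕ (i ⊕ d) ≡ (toℕ i + d) % N
toℕ-⊕ i d = toℕ-fromℕ< _

⊕-full : ∀ {N} (i : Fin N) k → i ⊕ (k * N) ≡ i
⊕-full {N} i k = toℕ-injective (begin
  toℕ (i ⊕ k * N)      ≡⟨ toℕ-⊕ i (k * N) ⟩
  (toℕ i + k * N) % N  ≡⟨ [m+kn]%n≡m%n (toℕ i) k N ⟩
  toℕ i % N            ≡⟨ m<n⇒m%n≡m (toℕ<n i) ⟩
  toℕ i                ∎)
  where
  open ≡-Reasoning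
  instance _ = nonZeroIndex i

⊕-⊕ : ∀ {N} (i : Fin N) d e → i ⊕ d ⊕ e ≡ i ⊕ (d + e)
⊕-⊕ {N} i d e = toℕ-injective (begin
  toℕ (i ⊕ d ⊕ e)                      ≡⟨ toℕ-⊕ (i ⊕ d) e ⟩
  (toℕ (i ⊕ d) + e) % N                ≡⟨ cong (λ z → (z + e) % N) (toℕ-⊕ i d) ⟩
  ((toℕ i + d) % N + e) % N            ≡⟨ %-distribˡ-+ ((toℕ i + d) % N) e N ⟩
  ((toℕ i + d) % N % N + e % N) % N    ≡⟨ cong (λ z → (z + e % N) % N) (m%n%n≡m%n (toℕ i + d) N) ⟩
  ((toℕ i + d) % N + e % N) % N        ≡⟨ %-distribˡ-+ (toℕ i + d) e N ⟨
  (toℕ i + d + e) % N                  ≡⟨ cong (_% N) (+-assoc (toℕ i) d e) ⟩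
  (toℕ i + (d + e)) % N                ≡⟨ toℕ-⊕ i (d + e) ⟨
  toℕ (i ⊕ (d + e))                    ∎)
  where
  open ≡-Reasoning
  instance _ = nonZeroIndex i

⊕-back : ∀ {N} (i : Fin N) d → i ⊕ d * pred N ⊕ d ≡ i
⊕-back {suc N} i d = begin
  i ⊕ d * N ⊕ d    ≡⟨ ⊕-⊕ i (d * N) d ⟩
  i ⊕ (d * N + d)  ≡⟨ cong (i ⊕_) (trans (+-comm (d * N) d) (sym (*-suc d N))) ⟩
  i ⊕ d * suc N    ≡⟨ ⊕-full i d ⟩
  i                ∎
  where
  open ≡-Reasoning

rotationOf-isEquivalence : ∀ {N} {A : Set} → IsEquivalence (RotationOf {N} {A})
rotationOf-isEquivalence {N} = record
  { refl  = λ {s} → 0 , λ i → cong s (sym (⊕-full i 0))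
  ; sym   = λ {s} {t} (d , p) → d * pred N , λ i →
              sym (trans (p (i ⊕ d * pred N)) (cong s (⊕-back i d)))
  ; trans = λ {s} {t} {u} (d , p) (e , q) → e + d , λ i →
              trans (q i) (trans (p (i ⊕ e)) (cong s (⊕-⊕ i e d)))
  }

-- For 2 ≤ k ≤ r there are n k families of size k, each a husband with k ∸ 1
-- wives; the values of n outside this range play no role.

module _ (r : ℕ) (n : ℕ → ℕ) where

  record Family : Set where
    constructor family
    field
      size   : ℕ
      .2≤size : 2 ≤ size
      .size≤r : size ≤ r
      index  : Fin (n size)

    wives : ℕ
    wives = size ∸ 1

open Family public using (wives)

module _ (r : ℕ) (n : ℕ → ℕ) (m w : ℕ) where

  data Person : Set where
    husband     : Family r n → Person
    wife        : (f : Family r n) → Fin (wives f) → Person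
    singleMan   : Fin m → Person
    singleWoman : Fin w → Person

  persons : ℕ
  persons = Σ[ 2 ⋯ r ] (λ k → n k * k) + m + w

module _ {r : ℕ} {n : ℕ → ℕ} {m w : ℕ} where

  data Man : Pred (Person r n m w) 0ℓ where
    husband   : ∀ f → Man (husband f)
    singleMan : ∀ i → Man (singleMan i)

  data Woman : Pred (Person r n m w) 0ℓ where
    wife        : ∀ f j → Woman (wife f j)
    singleWoman : ∀ i → Woman (singleWoman i)

  data _IsWifeOf_ : Person r n m w → Person r n m w → Set where
    wife : ∀ f j → wife f j IsWifeOf husband f

  data _∈Family_ : Person r n m w → Family r n → Set where
    husband : ∀ f → husband f ∈Family f
    wife    : ∀ f j → wife f j ∈Family f

  module _ {N : ℕ} (s : Fin N → Person r n m w) where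

    FamiliesTogether : Set
    FamiliesTogether = ∀ f → Consecutive (λ x → s x ∈Family f)

    OnlyOwnWivesAdjacent : Set
    OnlyOwnWivesAdjacent = ∀ x y → Adjacent x y →
      Man (s x) → Woman (s y) → s y IsWifeOf s x

    HusbandsSurrounded : Set
    HusbandsSurrounded = ∀ f → 1 < wives f →
      ∀ x y → s x ≡ husband f → Adjacent x y → s y IsWifeOf s x

module _ (r : ℕ) (n : ℕ → ℕ) (m w : ℕ) where

  record Seating : Set where
    field
      bijection : Fin (persons r n m w) ↔ Person r n m w

    occupant : Fin (persons r n m w) → Person r n m w
    occupant = Inverse.to bijection

    field
      familiesTogether     : FamiliesTogether occupant
      onlyOwnWivesAdjacent : OnlyOwnWivesAdjacent occupant
      husbandsSurrounded   : HusbandsSurrounded occupant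

  open Seating

  seatings : Setoid 0ℓ 0ℓ
  seatings = record
    { Carrier       = Seating
    ; _≈_           = λ s t → RotationOf (occupant s) (occupant t)
    ; isEquivalence = record
      { refl  = λ {s} → E.refl {occupant s}
      ; sym   = λ {s} {t} → E.sym {occupant s} {occupant t}
      ; trans = λ {s} {t} {u} → E.trans {occupant s} {occupant t} {occupant u}
      }
    }
    where module E = IsEquivalence (rotationOf-isEquivalence {persons r n m w} {Person r n m w})

{-# OPTIONS --safe #-}
module Submission where

-- A man sits next to a woman only inside a family.  A polygamous family has wives
-- at both ends, so it behaves like a single woman, and only couples separate the
-- circle into alternating runs of men and of women.  Reading the circle from a fixed
-- couple, starting with whichever spouse comes first, turns a seating up to rotation
-- into a line: at each step the next item is one of the remaining groups of the
-- current sex, or one of the remaining couples, after which the two sexes swap roles.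
-- The number of such lines depends only on how many couples, groups of the current
-- sex and groups of the other sex remain, and its recurrence is solved by a quotient
-- of factorials.  Starting with the husband or with the wife gives the same number.

open import Defs
open Family using (size)
open import Data.Nat.Base using (ℕ; zero; suc; pred; _+_; _*_; _∸_; _^_; _/_; _%_; _!; _≤_; _<_; z≤n; s≤s)
open import Data.Nat.Properties
open import Data.Nat.Divisibility using (_∣_; divides; m≤n⇒m!∣n!)
open import Data.Nat.DivMod using (m/n*n≡m; m*n/n≡m; m<n⇒m%n≡m; n%n≡0)
open import Data.Nat.ListAction using (sum; product)
open import Data.Nat.ListAction.Properties using (sum-++; product-++; product-↭)
open import Data.Nat.Tactic.RingSolver using (solve-∀)
open import Data.Fin.Base using (Fin; zero; suc; toℕ; fromℕ<)
open import Data.Fin.Properties as Fin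
  using (*↔×; +↔⊎; nonZeroIndex; toℕ<n; toℕ-injective; toℕ-fromℕ<)
open import Data.List.Base
  using (List; []; _∷_; _++_; length; lookup; removeAt; map; concat; concatMap; tabulate; allFin; applyUpTo)
open import Data.List.Properties
  using (∷-injective; length-++; length-map; length-removeAt; length-removeAt′; length-tabulate; map-++;
         map-tabulate; ++-assoc; applyUpTo-∷ʳ; lookup-applyUpTo; tabulate-cong; tabulate-lookup)
open import Data.List.Membership.Propositional using (_∈_; find)
open import Data.List.Membership.Propositional.Properties
  using (∈-++⁻; ∈-++⁺ˡ; ∈-++⁺ʳ; ∈-lookup; ∈-map⁺; ∈-map⁻; ∈-concatMap⁻; ∈-concatMap⁺; ∈-concat⁺′;
         ∈-concat⁻′; ∈-allFin; ∈-tabulate⁺; ∈-tabulate⁻; ∈-applyUpTo⁺)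
open import Data.List.Membership.Propositional.Properties.WithK using (unique∧set⇒bag)
open import Data.List.Relation.Unary.All as All using (All; []; _∷_)
import Data.List.Relation.Unary.All.Properties as All
open import Data.List.Relation.Unary.AllPairs as AllPairs using ([]; _∷_)
import Data.List.Relation.Unary.AllPairs.Properties as AllPairs
open import Data.List.Relation.Unary.Any as Any using (here; there)
open import Data.List.Relation.Unary.Any.Properties using (lookup-index)
open import Data.List.Relation.Unary.Linked using (Linked; []; [-]; _∷_)
import Data.List.Relation.Unary.Linked.Properties as Linked
open import Data.List.Relation.Unary.Unique.Propositional using (Unique)
import Data.List.Relation.Unary.Unique.Propositional.Properties as Unique
open import Data.List.Relation.Binary.BagAndSetEquality using (∼bag⇒↭)
open import Data.List.Relation.Binary.Permutation.Propositional as ↭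
  using (_↭_; refl; prep; swap; ↭-refl; ↭-sym; ↭-trans; ↭-reflexive; ↭⇒↭ₛ)
open import Data.List.Relation.Binary.Permutation.Propositional.Properties
  using (All-resp-↭; ∈-resp-↭; drop-∷; ↭-length; ↭-empty-inv; ++⁺; ++⁺ˡ; ++⁺ʳ; ++-comm; map⁺; shift; shifts)
import Data.List.Relation.Binary.Permutation.Setoid.Properties as ↭ₛ
open import Data.Product.Base using (Σ; ∃; _×_; _,_; proj₁; proj₂)
open import Data.Product.Function.Dependent.Propositional using (congˡ)
open import Data.Product.Function.NonDependent.Propositional using (_×-cong_)
open import Data.Sum.Base using (_⊎_; inj₁; inj₂)
open import Data.Sum.Function.Propositional using (_⊎-cong_)
open import Data.Unit.Base using (⊤; tt)
open import Function.Base using (_∘_; _$_; id; const)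
open import Function.Bundles using (_↔_; mk↔ₛ′; mk⇔; Inverse; Equivalence)
open import Function.Properties.Inverse using (↔-sym; ↔-trans)
open import Level using (0ℓ)
open import Relation.Nullary using (¬_; Dec; yes; no; contradiction; recompute)
open import Relation.Unary using (Pred; ∁)
open import Relation.Binary.Bundles using (Setoid)
open import Relation.Binary.Core using (Rel)
open import Relation.Binary.PropositionalEquality
  using (_≡_; _≢_; refl; sym; trans; cong; cong₂; subst; setoid; module ≡-Reasoning)
open import Relation.Binary.Structures using (IsEquivalence)

-- The quotient of factorials comes from runs. A line with `c` couples, ordered in `c !` ways, is
-- cut into `c + 1` runs alternating in sex, and `a` groups are spread over `q + 1` runs in
-- `(a + q) ! / q !` ways. With one couple fixed, `n 2 ∸ 1 = 2 q + 1` couples remain, so each sex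
-- gets `q + 1 = n 2 / 2` runs; this is why both starting spouses give the same number. The factor 2
-- for the starting spouse turns `(2 q + 1) ! / q !` into `n 2 ! / (n 2 / 2) !`. Evenness of `n 2`
-- closes the circle: after all couples the expected sex is again that of the first person. The main
-- obstacle is the passage between circle and list. A cyclic interval may wrap around, so contiguity
-- in the list is derived only for families avoiding the first seat, while the fixed couple fills
-- the first two seats. The closing adjacency is expressed by repeating the first person at the end
-- of the list.

private variable
  A B : Set
  N : ℕ

-- Lists

remove-↭ : ∀ (xs : List A) i → xs ↭ lookup xs i ∷ removeAt xs i
remove-↭ (x ∷ xs) zero    = ↭-refl
remove-↭ (x ∷ xs) (suc i) = ↭-trans (prep x (remove-↭ xs i)) (swap _ _ ↭-refl)

remove-∈-↭ : ∀ {x} {xs : List A} (x∈xs : x ∈ xs) → xs ↭ x ∷ removeAt xs (Any.index x∈xs)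
remove-∈-↭ {x = x} {xs} x∈xs =
  subst (λ y → xs ↭ y ∷ removeAt xs (Any.index x∈xs)) (sym (lookup-index x∈xs)) (remove-↭ xs _)

Unique-resp-↭ : {xs ys : List A} → xs ↭ ys → Unique xs → Unique ys
Unique-resp-↭ p = ↭ₛ.Unique-resp-↭ (setoid _) (↭⇒↭ₛ p)

Unique-tail : ∀ {x} {xs : List A} → Unique (x ∷ xs) → Unique xs
Unique-tail (_ ∷ u) = u

Unique-++ʳ : ∀ (xs : List A) {ys} → Unique (xs ++ ys) → Unique ys
Unique-++ʳ []       u       = u
Unique-++ʳ (x ∷ xs) (_ ∷ u) = Unique-++ʳ xs u

Unique-++ˡ : ∀ (xs : List A) {ys} → Unique (xs ++ ys) → Unique xs
Unique-++ˡ []       u       = []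
Unique-++ˡ (x ∷ xs) (p ∷ u) =
  All.tabulate (λ q → All.lookup p (∈-++⁺ˡ q)) ∷ Unique-++ˡ xs u

lookup-injective : {xs : List A} → Unique xs → ∀ {i j} → lookup xs i ≡ lookup xs j → i ≡ j
lookup-injective (p ∷ u) {zero}  {zero}  e = refl
lookup-injective (p ∷ u) {zero}  {suc j} e = contradiction e (All.lookup p (∈-lookup j))
lookup-injective (p ∷ u) {suc i} {zero}  e = contradiction (sym e) (All.lookup p (∈-lookup i))
lookup-injective (p ∷ u) {suc i} {suc j} e = cong suc (lookup-injective u e)

removeAt-Unique : ∀ {xs : List A} i → Unique xs → Unique (removeAt xs i)
removeAt-Unique {xs = xs} i u = Unique-tail (Unique-resp-↭ (remove-↭ xs i) u)

unique∧set⇒↭ : {xs ys : List A} → Unique xs → Unique ys →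
  (∀ {x} → x ∈ xs → x ∈ ys) → (∀ {x} → x ∈ ys → x ∈ xs) → xs ↭ ys
unique∧set⇒↭ u v f g = ∼bag⇒↭ (unique∧set⇒bag u v (mk⇔ f g))

concatMap-↭ : ∀ (f : A → List B) {xs ys} → xs ↭ ys → concatMap f xs ↭ concatMap f ys
concatMap-↭ f refl         = ↭-refl
concatMap-↭ f (prep x p)   = ++⁺ˡ (f x) (concatMap-↭ f p)
concatMap-↭ f (swap x y p) =
  ↭-trans (shifts (f x) (f y)) (++⁺ˡ (f y) (++⁺ˡ (f x) (concatMap-↭ f p)))
concatMap-↭ f (↭.trans p q)  = ↭-trans (concatMap-↭ f p) (concatMap-↭ f q)

Linked-tail : ∀ {R : Rel A 0ℓ} {x xs} → Linked R (x ∷ xs) → Linked R xs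
Linked-tail [-]     = []
Linked-tail (_ ∷ l) = l

-- Contiguity of a property along a list.

module _ (P : Pred A 0ℓ) where

  data Run : Pred (List A) 0ℓ where
    stop : ∀ {xs} → All (∁ P) xs → Run xs
    _∷_  : ∀ {x xs} → P x → Run xs → Run (x ∷ xs)

  -- The linear counterpart of `Consecutive`, as a pattern no, yes, no whose phases may be empty.
  -- Having no indices, it survives removal of the front of the list.
  data Contiguous : Pred (List A) 0ℓ where
    start : ∀ {xs} → Run xs → Contiguous xs
    _∷_   : ∀ {x xs} → ¬ P x → Contiguous xs → Contiguous (x ∷ xs)

module _ {P : Pred A 0ℓ} where

  Run-++ : ∀ {xs ys} → All P xs → Run P ys → Run P (xs ++ ys)
  Run-++ []       r = r
  Run-++ (p ∷ ps) r = p ∷ Run-++ ps r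

  Contiguous-++ : ∀ {xs ys} → All (∁ P) xs → Contiguous P ys → Contiguous P (xs ++ ys)
  Contiguous-++ []       c = c
  Contiguous-++ (p ∷ ps) c = p ∷ Contiguous-++ ps c

  Contiguous-tail : ∀ {x xs} → Contiguous P (x ∷ xs) → Contiguous P xs
  Contiguous-tail (start (stop (_ ∷ ps))) = start (stop ps)
  Contiguous-tail (start (_ ∷ r))         = start r
  Contiguous-tail (_ ∷ c)                 = c

  Contiguous-++ʳ : ∀ xs {ys} → Contiguous P (xs ++ ys) → Contiguous P ys
  Contiguous-++ʳ []       c = c
  Contiguous-++ʳ (x ∷ xs) c = Contiguous-++ʳ xs (Contiguous-tail c)

  Contiguous-head : ∀ {x xs} → P x → Contiguous P (x ∷ xs) → Run P xs
  Contiguous-head p (start (stop (¬p ∷ _))) = contradiction p ¬p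
  Contiguous-head p (start (_ ∷ r))         = r
  Contiguous-head p (¬p ∷ _)                = contradiction p ¬p

-- Cardinalities

resize : ∀ {m n} → m ≡ n → A ↔ Fin m → A ↔ Fin n
resize {A = A} e = subst (λ k → A ↔ Fin k) e

⊎-size : ∀ {m n} → A ↔ Fin m → B ↔ Fin n → (A ⊎ B) ↔ Fin (m + n)
⊎-size f g = ↔-trans (f ⊎-cong g) (↔-sym +↔⊎)

×-size : ∀ {m n} → A ↔ Fin m → B ↔ Fin n → (A × B) ↔ Fin (m * n)
×-size f g = ↔-trans (f ×-cong g) (↔-sym *↔×)

Σ-size : ∀ {m n} {B : Fin m → Set} → (∀ i → B i ↔ Fin n) → Σ (Fin m) B ↔ Fin (m * n)
Σ-size f = ↔-trans (congˡ (λ {i} → f i)) (↔-sym *↔×)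

-- An ordering is given by successive positions in what is left, so that its count `k !` follows the
-- recursion; different positions yield different lists once the entries are distinct.
data Perm {A : Set} : List A → Set where
  []   : Perm []
  pick : ∀ {xs} (i : Fin (length xs)) → Perm (removeAt xs i) → Perm xs

permute : {xs : List A} → Perm xs → List A
permute []                 = []
permute (pick {xs = xs} i π) = lookup xs i ∷ permute π

permute-↭ : ∀ {xs : List A} (π : Perm xs) → permute π ↭ xs
permute-↭ []                   = ↭-refl
permute-↭ (pick {xs = xs} i π) = ↭-trans (prep _ (permute-↭ π)) (↭-sym (remove-↭ xs i))

-- The tails `u` and `v` are arbitrary so that a block can be cut off from whatever follows it in a
-- line.
permute-injective : ∀ {xs : List A} {u v} → Unique xs → (π ρ : Perm xs) →
  permute π ++ u ≡ permute ρ ++ v → π ≡ ρ × u ≡ v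
permute-injective _ []         []         e = refl , e
permute-injective U (pick i π) (pick j ρ) e with ∷-injective e
... | e₁ , e₂ with refl ← lookup-injective U {i} {j} e₁
              with refl , e₃ ← permute-injective (removeAt-Unique i U) π ρ e₂ = refl , e₃

Perm-cons : ∀ {x} {xs : List A} →
  Perm (x ∷ xs) ↔ Σ (Fin (length (x ∷ xs))) (λ i → Perm (removeAt (x ∷ xs) i))
Perm-cons = mk↔ₛ′ (λ { (pick i π) → i , π }) (λ (i , π) → pick i π)
                  (λ _ → refl) (λ { (pick _ _) → refl })

Perm-size : ∀ {k} (xs : List A) → length xs ≡ k → Perm xs ↔ Fin (k !)
Perm-size []       refl = mk↔ₛ′ (λ _ → zero) (λ _ → []) (λ { zero → refl }) (λ { [] → refl })
Perm-size {k = suc k} (x ∷ xs) e =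
  resize (cong (_* (k !)) e) (↔-trans Perm-cons (Σ-size (λ i →
    Perm-size (removeAt (x ∷ xs) i) (trans (length-removeAt (x ∷ xs) i) (suc-injective e)))))

-- What may follow the first wife of a family with husband h and further wives
-- xs: h comes somewhere, but not last.

data Followed {A : Set} (h : A) : List A → Set where
  now   : ∀ {xs} (i : Fin (length xs)) → Perm (removeAt xs i) → Followed h xs
  later : ∀ {xs} (i : Fin (length xs)) → Followed h (removeAt xs i) → Followed h xs

module _ {h : A} where

  followed : ∀ {xs} → Followed h xs → List A
  followed (now   {xs = xs} i π) = h ∷ lookup xs i ∷ permute π
  followed (later {xs = xs} i φ) = lookup xs i ∷ followed φ

  followed-↭ : ∀ {xs} (φ : Followed h xs) → followed φ ↭ h ∷ xs
  followed-↭ (now   {xs = xs} i π) =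
    prep h (↭-trans (prep _ (permute-↭ π)) (↭-sym (remove-↭ xs i)))
  followed-↭ (later {xs = xs} i φ) =
    ↭-trans (prep _ (followed-↭ φ)) (↭-trans (swap _ _ ↭-refl) (prep h (↭-sym (remove-↭ xs i))))

  followed-injective : ∀ {xs u v} → Unique (h ∷ xs) → (φ ψ : Followed h xs) →
    followed φ ++ u ≡ followed ψ ++ v → φ ≡ ψ × u ≡ v
  followed-injective (_ ∷ U) (now i π) (now j ρ) e with ∷-injective (proj₂ (∷-injective e))
  ... | e₁ , e₂ with refl ← lookup-injective U {i} {j} e₁
                with refl , e₃ ← permute-injective (removeAt-Unique i U) π ρ e₂ = refl , e₃
  followed-injective (p ∷ _) (now i π) (later j ψ) e =
    contradiction (proj₁ (∷-injective e)) (All.lookup p (∈-lookup j))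
  followed-injective (p ∷ _) (later i φ) (now j ρ) e =
    contradiction (sym (proj₁ (∷-injective e))) (All.lookup p (∈-lookup i))
  followed-injective U (later {xs = xs} i φ) (later j ψ) e with ∷-injective e
  ... | e₁ , e₂ with refl ← lookup-injective (Unique-tail U) {i} {j} e₁
                with refl , e₃ ← followed-injective
                       (Unique-tail (Unique-resp-↭ (↭-trans (prep h (remove-↭ xs i)) (swap _ _ ↭-refl)) U))
                       φ ψ e₂ = refl , e₃

  Followed-cases : ∀ {xs} → Followed h xs ↔
    (Σ (Fin (length xs)) (λ i → Perm (removeAt xs i)) ⊎
     Σ (Fin (length xs)) (λ i → Followed h (removeAt xs i)))
  Followed-cases = mk↔ₛ′
    (λ { (now i π) → inj₁ (i , π) ; (later i φ) → inj₂ (i , φ) })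
    (λ { (inj₁ (i , π)) → now i π ; (inj₂ (i , φ)) → later i φ })
    (λ { (inj₁ _) → refl ; (inj₂ _) → refl })
    (λ { (now _ _) → refl ; (later _ _) → refl })

  -- The `k` wives have `k !` orders, and `h` goes directly before any one of them, which gives the
  -- factor `k`.
  Followed-size : ∀ {k} xs → length xs ≡ k → Followed h xs ↔ Fin (k * k !)
  Followed-size []       refl = mk↔ₛ′ (λ { (now () _) ; (later () _) }) (λ ()) (λ ())
                                      (λ { (now () _) ; (later () _) })
  Followed-size {suc k} (x ∷ xs) e =
    resize
      (trans (cong (λ l → l * k ! + l * (k * k !)) e) (sym (*-distribˡ-+ (suc k) (k !) (k * k !))))
      (↔-trans Followed-cases (⊎-size
        (Σ-size (λ i → Perm-size (removeAt (x ∷ xs) i) (len i)))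
        (Σ-size (λ i → Followed-size (removeAt (x ∷ xs) i) (len i)))))
    where
    len : ∀ i → length (removeAt (x ∷ xs) i) ≡ k
    len i = trans (length-removeAt (x ∷ xs) i) (suc-injective e)

-- Reading one group off the front of a list.

module _ {P : Pred A 0ℓ} where

  private
    in-left : ∀ {x xs R} → P x → All (∁ P) R → x ∈ xs ++ R → x ∈ xs
    in-left {xs = xs} px out x∈ with ∈-++⁻ xs x∈
    ... | inj₁ x∈xs = x∈xs
    ... | inj₂ x∈R  = contradiction px (All.lookup out x∈R)

  module _ {Q : Pred A 0ℓ} {_~_ : Rel A 0ℓ} {y : A} where

    -- A run of P-elements that exhausts xs orders xs; z is the element
    -- preceding the remainder u, needed to continue reading from u.

    Reading : (L b R : List A) → Set
    Reading L b R = ∃ λ u → ∃ λ z → L ≡ b ++ u × u ↭ R × Q z × Linked _~_ (z ∷ u ++ y ∷ [])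

    -- Since nobody in `R` satisfies `P`, the list `xs` holds exactly the `P`-elements of `L`, and
    -- `Run` puts them first. `Q` travels along so that it is known of the last element read.
    read-perm : ∀ {x xs R} L → L ↭ xs ++ R → Run P L → All P xs → All (∁ P) R →
      Q x → All Q xs → Linked _~_ (x ∷ L ++ y ∷ []) → Σ (Perm xs) λ π → Reading L (permute π) R
    read-perm {x} {[]} L e r Pxs out Qx Qxs l = [] , L , x , refl , e , Qx , l
    read-perm {xs = _ ∷ _} L e (stop no′) (px ∷ _) out Qx Qxs l =
      contradiction px (All.lookup no′ (∈-resp-↭ (↭-sym e) (here refl)))
    read-perm {xs = xs@(_ ∷ _)} {R} (p ∷ L) e (pp ∷ r) Pxs out Qx Qxs (_ ∷ l) =
      let p∈   = in-left {xs = xs} pp out (∈-resp-↭ e (here refl))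
          Pxs′ = All-resp-↭ (remove-∈-↭ p∈) Pxs
          Qxs′ = All-resp-↭ (remove-∈-↭ p∈) Qxs
          π , u , z , eq , rest = read-perm L (drop-∷ (↭-trans e (++⁺ʳ R (remove-∈-↭ p∈)))) r
            (All.tail Pxs′) out (All.head Qxs′) (All.tail Qxs′) l
      in pick (Any.index p∈) π , u , z , cong₂ _∷_ (lookup-index p∈) eq , rest

    -- The first hypothesis says that whoever comes after `h` satisfies `P`, so `h` cannot end the
    -- run: the next element would be outside `P`, or be `y`.
    read-followed : ∀ {h x xs R} L → (∀ {p} → h ~ p → P p) → L ↭ h ∷ xs ++ R → Run P L →
      P h → All P xs → All (∁ P) R → ¬ P y →
      All Q xs → Linked _~_ (x ∷ L ++ y ∷ []) → Σ (Followed h xs) λ φ → Reading L (followed φ) R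
    read-followed L f e (stop no′) Ph Pxs out ¬Py Qxs l =
      contradiction Ph (All.lookup no′ (∈-resp-↭ (↭-sym e) (here refl)))
    read-followed {h} {xs = xs} {R} (p ∷ L) f e (pp ∷ r) Ph Pxs out ¬Py Qxs (_ ∷ l)
      with in-left {xs = h ∷ xs} pp out (∈-resp-↭ e (here refl))
    ... | there p∈ =
      let Pxs′ = All-resp-↭ (remove-∈-↭ p∈) Pxs
          Qxs′ = All-resp-↭ (remove-∈-↭ p∈) Qxs
          e′   = ↭-trans e (↭-trans (prep h (++⁺ʳ R (remove-∈-↭ p∈))) (swap _ _ ↭-refl))
          φ , u , z , eq , rest = read-followed L f (drop-∷ e′) r
             Ph (All.tail Pxs′) out ¬Py (All.tail Qxs′) l
      in later (Any.index p∈) φ , u , z , cong₂ _∷_ (lookup-index p∈) eq , rest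
    -- Here `h` ends the whole line, so its right neighbour is the closing person `y`.
    read-followed (p ∷ []) f e (pp ∷ r) Ph Pxs out ¬Py Qxs (_ ∷ h~y ∷ l)
        | here refl = contradiction (f h~y) ¬Py
    read-followed (p ∷ q ∷ L) f e (pp ∷ stop (¬Pq ∷ _)) Ph Pxs out ¬Py Qxs (_ ∷ h~q ∷ l)
        | here refl = contradiction (f h~q) ¬Pq
    read-followed {h} {xs = xs} {R} (p ∷ q ∷ L) f e (pp ∷ pq ∷ r) Ph Pxs out ¬Py Qxs (_ ∷ _ ∷ l)
        | here refl =
      let q∈   = in-left {xs = xs} pq out (∈-resp-↭ (drop-∷ e) (here refl))
          Pxs′ = All-resp-↭ (remove-∈-↭ q∈) Pxs
          Qxs′ = All-resp-↭ (remove-∈-↭ q∈) Qxs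
          π , u , z , eq , rest = read-perm L (drop-∷ (↭-trans (drop-∷ e) (++⁺ʳ R (remove-∈-↭ q∈)))) r
            (All.tail Pxs′) out (All.head Qxs′) (All.tail Qxs′) l
      in now (Any.index q∈) π , u , z , cong (h ∷_) (cong₂ _∷_ (lookup-index q∈) eq) , rest

  read-one : ∀ {q R} L → L ↭ q ∷ R → Run P L → P q → All (∁ P) R → ∃ λ u → L ≡ q ∷ u × u ↭ R
  read-one L e (stop no′) Pq out = contradiction Pq (All.lookup no′ (∈-resp-↭ (↭-sym e) (here refl)))
  read-one {q} (p ∷ L) e (pp ∷ r) Pq out with in-left {xs = q ∷ []} pp out (∈-resp-↭ e (here refl))
  ... | here refl = L , refl , drop-∷ e

-- Groups and lines of people

data Sex : Set where
  ♂ ♀ : Sex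

other : Sex → Sex
other ♂ = ♀
other ♀ = ♂

other-involutive : ∀ s → other (other s) ≡ s
other-involutive ♂ = refl
other-involutive ♀ = refl

other-≢ : ∀ s → s ≢ other s
other-≢ ♂ ()
other-≢ ♀ ()

-- The sex expected next after `k` couples have been passed.
others : Sex → ℕ → Sex
others s zero    = s
others s (suc k) = others (other s) k

index-of : ∀ {x : A} {xs} → x ∈ xs → ∃ λ i → lookup xs i ≡ x
index-of x∈xs = Any.index x∈xs , sym (lookup-index x∈xs)

Unique-disjoint : ∀ (xs : List A) {ys x} → Unique (xs ++ ys) → x ∈ xs → ¬ x ∈ ys
Unique-disjoint (_ ∷ _)  (p ∷ u) (here refl)  x∈ys = All.lookup p (∈-++⁺ʳ _ x∈ys) refl
Unique-disjoint (_ ∷ xs) (p ∷ u) (there x∈xs) x∈ys = Unique-disjoint xs u x∈xs x∈ys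

module Rounds (r : ℕ) (n : ℕ → ℕ) (m w : ℕ) (2≤r : 2 ≤ r) where

  private
    P : Set
    P = Person r n m w

  data Group : Set where
    fam   : Family r n → Group
    man   : Fin m → Group
    woman : Fin w → Group

  _≟ᴳ_ : (g h : Group) → Dec (g ≡ h)
  fam (family k _ _ i) ≟ᴳ fam (family l _ _ j) with k ≟ l
  ... | no k≢l = no λ { refl → k≢l refl }
  ... | yes refl with i Fin.≟ j
  ...   | yes refl = yes refl
  ...   | no i≢j = no λ { refl → i≢j refl }
  man i   ≟ᴳ man j with i Fin.≟ j
  ... | yes refl = yes refl
  ... | no i≢j   = no λ { refl → i≢j refl }
  woman i ≟ᴳ woman j with i Fin.≟ j
  ... | yes refl = yes refl
  ... | no i≢j   = no λ { refl → i≢j refl }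
  fam _   ≟ᴳ man _   = no λ ()
  fam _   ≟ᴳ woman _ = no λ ()
  man _   ≟ᴳ fam _   = no λ ()
  man _   ≟ᴳ woman _ = no λ ()
  woman _ ≟ᴳ fam _   = no λ ()
  woman _ ≟ᴳ man _   = no λ ()

  wivesOf : Family r n → List P
  wivesOf f = map (wife f) (allFin (wives f))

  members : Group → List P
  members (fam f)   = husband f ∷ wivesOf f
  members (man i)   = singleMan i ∷ []
  members (woman i) = singleWoman i ∷ []

  groupOf : P → Group
  groupOf (husband f)     = fam f
  groupOf (wife f _)      = fam f
  groupOf (singleMan i)   = man i
  groupOf (singleWoman i) = woman i

  InGroup : Group → Pred P 0ℓ
  InGroup g p = groupOf p ≡ g

  wivesOf⁻ : ∀ {f p} → p ∈ wivesOf f → ∃ λ j → p ≡ wife f j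
  wivesOf⁻ p∈ with j , _ , e ← ∈-map⁻ _ p∈ = j , e

  ∈-members : ∀ p → p ∈ members (groupOf p)
  ∈-members (husband f)     = here refl
  ∈-members (wife f j)      = there (∈-map⁺ (wife f) (∈-allFin j))
  ∈-members (singleMan _)   = here refl
  ∈-members (singleWoman _) = here refl

  ∈-members⁻ : ∀ g {p} → p ∈ members g → groupOf p ≡ g
  ∈-members⁻ (fam f)   (here refl) = refl
  ∈-members⁻ (fam f)   (there p∈) with _ , refl ← wivesOf⁻ p∈ = refl
  ∈-members⁻ (man _)   (here refl) = refl
  ∈-members⁻ (woman _) (here refl) = refl

  members-Unique : ∀ g → Unique (members g)
  members-Unique (fam f)   =
    All.tabulate (λ p∈ → λ { refl → case-⊥ (wivesOf⁻ p∈) }) ∷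
    Unique.map⁺ (λ { refl → refl }) (Unique.allFin⁺ (wives f))
    where
    case-⊥ : ¬ ∃ λ j → husband f ≡ wife f j
    case-⊥ (_ , ())
  members-Unique (man _)   = [] ∷ []
  members-Unique (woman _) = [] ∷ []

  outside : ∀ {h gs L} → Unique (h ∷ gs) → L ↭ concatMap members gs → All (∁ (InGroup h)) L
  outside (h∉ ∷ _) e = All-resp-↭ (↭-sym e) (All.tabulate λ p∈ eq →
    let g , g∈ , p∈g = find (∈-concatMap⁻ members p∈)
    in All.lookup h∉ g∈ (trans (sym eq) (∈-members⁻ g p∈g)))

  -- Conditions on neighbours, and the sexes of persons and groups.

  wife-group : ∀ {p q : P} → q IsWifeOf p → groupOf q ≡ groupOf p
  wife-group (wife f j) = refl

  -- Conditions (2) and (3) as seen from `p` looking at one neighbour `q`. Both only speak of pairs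
  -- of neighbours, so requiring this in both directions along the circle captures them.
  Tolerates : Rel P 0ℓ
  Tolerates p q = (Man p → Woman q → q IsWifeOf p) ×
                  (∀ f → 1 < wives f → p ≡ husband f → q IsWifeOf p)

  Compatible : Rel P 0ℓ
  Compatible p q = Tolerates p q × Tolerates q p

  wife-compatible : ∀ {p q} → q IsWifeOf p → Compatible p q
  wife-compatible v@(wife _ _) = ((λ _ _ → v) , (λ _ _ _ → v)) , ((λ ()) , (λ _ _ ()))

  compatible-sym : ∀ {p q} → Compatible p q → Compatible q p
  compatible-sym (a , b) = b , a

  -- The men and women who may sit next to a stranger of their own sex.

  data Calm : Sex → Pred P 0ℓ where
    husband     : ∀ {f} → ¬ 1 < wives f → Calm ♂ (husband f)
    singleMan   : ∀ {i} → Calm ♂ (singleMan i)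
    wife        : ∀ {f j} → Calm ♀ (wife f j)
    singleWoman : ∀ {i} → Calm ♀ (singleWoman i)

  calm-compatible : ∀ {s p q} → Calm s p → Calm s q → Compatible p q
  calm-compatible c d = calm-tolerates c d , calm-tolerates d c
    where
    calm-tolerates : ∀ {s p q} → Calm s p → Calm s q → Tolerates p q
    calm-tolerates (husband ¬1<) (husband _) =
      (λ _ ()) , λ { _ 1< refl → contradiction 1< ¬1< }
    calm-tolerates (husband ¬1<) singleMan   = (λ _ ()) , λ { _ 1< refl → contradiction 1< ¬1< }
    calm-tolerates singleMan     (husband _) = (λ _ ()) , λ _ _ ()
    calm-tolerates singleMan     singleMan   = (λ _ ()) , λ _ _ ()
    calm-tolerates wife          _           = (λ ()) , λ _ _ ()
    calm-tolerates singleWoman   _           = (λ ()) , λ _ _ ()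

  -- The sex is passed on across a group boundary: a neighbour of the opposite sex, or a polygamous
  -- husband next to an outsider, would force both persons into one group.
  compatible-calm : ∀ {s p q} → Calm s p → Compatible p q → groupOf p ≢ groupOf q → Calm s q
  compatible-calm {p = p} {q} c ok ne = go c q ok ne
    where
    ♀→ : ∀ {p q} → Woman p → Man q → Compatible p q → groupOf p ≡ groupOf q
    ♀→ a b (_ , t , _) = wife-group (t b a)
    ♂→ : ∀ {p q} → Man p → Woman q → Compatible p q → groupOf p ≡ groupOf q
    ♂→ a b ((t , _) , _) = sym (wife-group (t a b))
    surrounded : ∀ {p f} → Compatible p (husband f) → 1 < wives f → groupOf p ≡ fam f
    surrounded (_ , _ , t) 1< = wife-group (t _ 1< refl)
    go : ∀ {s p} → Calm s p → ∀ q → Compatible p q → groupOf p ≢ groupOf q → Calm s q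
    go {♂} c               (husband f) ok ne with 1 <? wives f
    ... | yes 1< = contradiction (surrounded ok 1<) ne
    ... | no ¬1< = husband ¬1<
    go {♂} c               (singleMan _)    ok ne = singleMan
    go {♂} (husband _)     (wife f j)       ok ne = contradiction (♂→ (husband _) (wife f j) ok) ne
    go {♂} singleMan       (wife f j)       ok ne = contradiction (♂→ (singleMan _) (wife f j) ok) ne
    go {♂} (husband _)     (singleWoman i)  ok ne = contradiction (♂→ (husband _) (singleWoman i) ok) ne
    go {♂} singleMan       (singleWoman i)  ok ne = contradiction (♂→ (singleMan _) (singleWoman i) ok) ne
    go {♀} c               (wife f j)       ok ne = wife
    go {♀} c               (singleWoman _)  ok ne = singleWoman
    go {♀} wife            (husband f)      ok ne = contradiction (♀→ (wife _ _) (husband f) ok) ne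
    go {♀} singleWoman     (husband f)      ok ne = contradiction (♀→ (singleWoman _) (husband f) ok) ne
    go {♀} wife            (singleMan i)    ok ne = contradiction (♀→ (wife _ _) (singleMan i) ok) ne
    go {♀} singleWoman     (singleMan i)    ok ne = contradiction (♀→ (singleWoman _) (singleMan i) ok) ne

  couple : Fin (n 2) → Family r n
  couple c = family 2 ≤-refl 2≤r c

  pair : Fin (n 2) → Group
  pair c = fam (couple c)

  spouse : Sex → Fin (n 2) → P
  spouse ♂ c = husband (couple c)
  spouse ♀ c = wife (couple c) zero

  spouse-group : ∀ s c → groupOf (spouse s c) ≡ pair c
  spouse-group ♂ c = refl
  spouse-group ♀ c = refl

  spouse-injective : ∀ s {c d} → spouse s c ≡ spouse s d → c ≡ d
  spouse-injective ♂ refl = refl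
  spouse-injective ♀ refl = refl

  spouse-calm : ∀ s c → Calm s (spouse s c)
  spouse-calm ♂ c = husband λ { (s≤s ()) }
  spouse-calm ♀ c = wife

  spouse-compatible : ∀ s c → Compatible (spouse s c) (spouse (other s) c)
  spouse-compatible ♂ c = wife-compatible (wife _ _)
  spouse-compatible ♀ c = compatible-sym (wife-compatible (wife _ _))

  spouses-↭ : ∀ s c → spouse s c ∷ spouse (other s) c ∷ [] ↭ members (pair c)
  spouses-↭ ♂ c = ↭-refl
  spouses-↭ ♀ c = swap _ _ ↭-refl

  calm-spouse : ∀ s {c p} → Calm s p → p ∈ members (pair c) → p ≡ spouse s c
  calm-spouse ♂ _  (here refl)         = refl
  calm-spouse ♂ () (there (here refl))
  calm-spouse ♀ () (here refl)
  calm-spouse ♀ _  (there (here refl)) = refl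

  -- The groups whose outer members are both of the given sex.

  data OfSex : Sex → Pred Group 0ℓ where
    man♂   : ∀ {i} → OfSex ♂ (man i)
    woman♀ : ∀ {i} → OfSex ♀ (woman i)
    fam♀   : ∀ {f} → 1 < wives f → OfSex ♀ (fam f)

  -- The only members of a sex different from that of their group are polygamous husbands, and these
  -- are not calm.
  calm-sex : ∀ {s t g p} → OfSex t g → p ∈ members g → Calm s p → s ≡ t
  calm-sex man♂      (here refl) singleMan     = refl
  calm-sex woman♀    (here refl) singleWoman   = refl
  calm-sex (fam♀ 1<) (here refl) (husband ¬1<) = contradiction 1< ¬1<
  calm-sex (fam♀ 1<) (there p∈)  c with _ , refl ← wivesOf⁻ p∈ with c
  ... | wife = refl

  -- Choosing a first wife and then a `Followed` list keeps the husband away from both ends. For a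
  -- couple the type is empty; couples enter a line through `turn` instead.
  Arrangement : Group → Set
  Arrangement (fam f)   = Σ (Fin (length (wivesOf f))) λ i → Followed (husband f) (removeAt (wivesOf f) i)
  Arrangement (man _)   = ⊤
  Arrangement (woman _) = ⊤

  block : ∀ g → Arrangement g → List P
  block (fam f)   (i , φ) = lookup (wivesOf f) i ∷ followed φ
  block (man i)   _       = singleMan i ∷ []
  block (woman i) _       = singleWoman i ∷ []

  block-↭ : ∀ g (a : Arrangement g) → block g a ↭ members g
  block-↭ (fam f) (i , φ) =
    ↭-trans (prep _ (followed-↭ φ)) (↭-trans (swap _ _ ↭-refl) (prep _ (↭-sym (remove-↭ (wivesOf f) i))))
  block-↭ (man _)   _ = ↭-refl
  block-↭ (woman _) _ = ↭-refl

  block-group : ∀ g (a : Arrangement g) → All (InGroup g) (block g a)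
  block-group g a = All-resp-↭ (↭-sym (block-↭ g a)) (All.tabulate (∈-members⁻ g))

  block-≢[] : ∀ g (a : Arrangement g) → ∃ λ p → ∃ λ u → block g a ≡ p ∷ u
  block-≢[] (fam _)   _ = _ , _ , refl
  block-≢[] (man _)   _ = _ , _ , refl
  block-≢[] (woman _) _ = _ , _ , refl

  block-head : ∀ {g} (a : Arrangement g) {u p v} → block g a ++ u ≡ p ∷ v → groupOf p ≡ g
  block-head {g} a e with block g a | block-≢[] g a | block-group g a
  block-head a refl | _ | _ , _ , refl | q ∷ _ = q

  block-injective : ∀ g (a b : Arrangement g) {u v} → block g a ++ u ≡ block g b ++ v → a ≡ b × u ≡ v
  block-injective (fam f) (i , φ) (j , ψ) e with ∷-injective e
  ... | e₁ , e₂ with refl ← lookup-injective (Unique-tail (members-Unique (fam f))) {i} {j} e₁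
                with refl , e₃ ← followed-injective
                       (Unique-tail (Unique-resp-↭
                         (↭-trans (prep _ (remove-↭ (wivesOf f) i)) (swap _ _ ↭-refl))
                         (members-Unique (fam f)))) φ ψ e₂ = refl , e₃
  block-injective (man _)   _ _ e = refl , proj₂ (∷-injective e)
  block-injective (woman _) _ _ e = refl , proj₂ (∷-injective e)

  -- Quantifying over the preceding calm person makes blocks composable without knowing who ends the
  -- previous block.
  Follows : Sex → Pred (List P) 0ℓ
  Follows s L = ∀ {p} → Calm s p → Linked Compatible (p ∷ L)

  permute-follows : ∀ {s ps L} → All (Calm s) ps → (π : Perm ps) → Follows s L → Follows s (permute π ++ L)
  permute-follows cs []                   l = l
  permute-follows cs (pick {xs = ps} i π) l c with All-resp-↭ (remove-↭ ps i) cs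
  ... | d ∷ ds = calm-compatible c d ∷ permute-follows ds π l d

  followed-follows : ∀ {f ps L} → All (_IsWifeOf husband f) ps → (φ : Followed (husband f) ps) →
    Follows ♀ L → ∀ {p} → p IsWifeOf husband f → Linked Compatible (p ∷ followed φ ++ L)
  followed-follows vs (now {xs = ps} i π) l v with All-resp-↭ (remove-↭ ps i) vs
  ... | u ∷ us = compatible-sym (wife-compatible v) ∷ wife-compatible u ∷
                 permute-follows (All.map (λ { (wife _ _) → wife }) us) π l (calm u)
    where
    calm : ∀ {f p} → p IsWifeOf husband f → Calm ♀ p
    calm (wife _ _) = wife
  followed-follows vs (later {xs = ps} i φ) l v@(wife _ _) with lookup ps i | All-resp-↭ (remove-↭ ps i) vs
  ... | _ | u@(wife _ _) ∷ us = calm-compatible wife wife ∷ followed-follows us φ l u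

  wivesOf-wives : ∀ f → All (_IsWifeOf husband f) (wivesOf f)
  wivesOf-wives f = All.tabulate λ p∈ → is-wife (wivesOf⁻ p∈)
    where
    is-wife : ∀ {p} → (∃ λ j → p ≡ wife f j) → p IsWifeOf husband f
    is-wife (j , refl) = wife f j

  block-follows : ∀ {s g L} → OfSex s g → (a : Arrangement g) → Follows s L → Follows s (block g a ++ L)
  block-follows man♂   a l c = calm-compatible c singleMan ∷ l singleMan
  block-follows woman♀ a l c = calm-compatible c singleWoman ∷ l singleWoman
  block-follows (fam♀ {f} _) (i , φ) l c
    with lookup (wivesOf f) i | All-resp-↭ (remove-↭ (wivesOf f) i) (wivesOf-wives f)
  ... | _ | v@(wife _ _) ∷ vs = calm-compatible c wife ∷ followed-follows vs φ l v

  Sexed : Sex → Pred (List Group) 0ℓ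
  Sexed s = All (OfSex s)

  groups : List (Fin (n 2)) → List Group → List Group → List Group
  groups cs as bs = map pair cs ++ as ++ bs

  groups-item : ∀ cs as bs i → groups cs as bs ↭ lookup as i ∷ groups cs (removeAt as i) bs
  groups-item cs as bs i = ↭-trans (++⁺ˡ (map pair cs) (++⁺ʳ bs (remove-↭ as i))) (shift _ (map pair cs) _)

  groups-couple : ∀ cs as bs i → groups cs as bs ↭ pair (lookup cs i) ∷ groups (removeAt cs i) bs as
  groups-couple cs as bs i = ++⁺ (map⁺ pair (remove-↭ cs i)) (++-comm as bs)

  -- A line of people read from left to right, the next person being of sex s
  -- unless the line has ended: cs are the couples still to come, as and bs the
  -- other groups, bounded by people of sex s and of the other sex.  Only a
  -- couple separates men from women.

  data Line : Sex → List (Fin (n 2)) → List Group → List Group → Set where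
    done : ∀ {s} → Line s [] [] []
    item : ∀ {s cs as bs} (i : Fin (length as)) → Arrangement (lookup as i) →
           Line s cs (removeAt as i) bs → Line s cs as bs
    turn : ∀ {s cs as bs} (i : Fin (length cs)) →
           Line (other s) (removeAt cs i) bs as → Line s cs as bs

  people : ∀ {s cs as bs} → Line s cs as bs → List P
  people done                            = []
  people (item {as = as} i a ℓ)          = block (lookup as i) a ++ people ℓ
  people (turn {s = s} {cs = cs} i ℓ)    =
    spouse s (lookup cs i) ∷ spouse (other s) (lookup cs i) ∷ people ℓ

  people-↭ : ∀ {s cs as bs} (ℓ : Line s cs as bs) → people ℓ ↭ concatMap members (groups cs as bs)
  people-↭ done = ↭-refl
  people-↭ (item {cs = cs} {as} {bs} i a ℓ) =
    ↭-trans (++⁺ (block-↭ _ a) (people-↭ ℓ)) (↭-sym (concatMap-↭ members (groups-item cs as bs i)))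
  people-↭ (turn {s} {cs} {as} {bs} i ℓ) =
    ↭-trans (++⁺ (spouses-↭ s (lookup cs i)) (people-↭ ℓ))
            (↭-sym (concatMap-↭ members (groups-couple cs as bs i)))

  -- The group of the first person reveals the constructor and the position chosen, because the
  -- groups are distinct; the block is then cut off and the rest compared.
  people-injective : ∀ {s cs as bs} → Unique (groups cs as bs) →
    (ℓ ℓ′ : Line s cs as bs) → people ℓ ≡ people ℓ′ → ℓ ≡ ℓ′
  people-injective U done done e = refl
  people-injective {cs = cs} {as} {bs} U (item i a ℓ) (item j b ℓ′) e
    with p , u , eq ← block-≢[] (lookup as j) b
    with refl ← lookup-injective (Unique-++ˡ as (Unique-++ʳ (map pair cs) U)) {i} {j}
                  (trans (sym (block-head a (trans e (cong (_++ people ℓ′) eq))))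
                         (block-head b {u = []} (cong (_++ []) eq)))
    with refl , e′ ← block-injective (lookup as i) a b e
    with refl ← people-injective (Unique-tail (Unique-resp-↭ (groups-item cs as bs i) U)) ℓ ℓ′ e′ = refl
  people-injective {s} {cs} {as} {bs} U (turn i ℓ) (turn j ℓ′) e
    with e₁ , e₂ ← ∷-injective e
    with refl ← lookup-injective (Unique.map⁻ (Unique-++ˡ (map pair cs) U)) {i} {j} (spouse-injective s e₁)
    with refl ← people-injective (Unique-tail (Unique-resp-↭ (groups-couple cs as bs i) U)) ℓ ℓ′
                  (proj₂ (∷-injective e₂)) = refl
  people-injective {s} {cs} {as} {bs} U (item i a ℓ) (turn j ℓ′) e =
    contradiction (subst (_∈ as ++ bs) (trans (sym (block-head a e)) (spouse-group s _)) (∈-++⁺ˡ (∈-lookup {xs = as} i)))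
                  (Unique-disjoint (map pair cs) U (∈-map⁺ pair (∈-lookup {xs = cs} j)))
  people-injective {s} {cs} {as} {bs} U (turn j ℓ) (item i a ℓ′) e =
    contradiction (subst (_∈ as ++ bs) (trans (sym (block-head a (sym e))) (spouse-group s _)) (∈-++⁺ˡ (∈-lookup {xs = as} i)))
                  (Unique-disjoint (map pair cs) U (∈-map⁺ pair (∈-lookup {xs = cs} j)))

  -- Every couple flips the expected sex, so the continuation `L` has to suit the sex after
  -- `length cs` flips.
  people-follows : ∀ {s cs as bs L} → Sexed s as → Sexed (other s) bs → (ℓ : Line s cs as bs) →
    Follows (others s (length cs)) L → Follows s (people ℓ ++ L)
  people-follows S T done l = l
  people-follows {s} {cs} {as} {L = L} S T (item i a ℓ) l with All-resp-↭ (remove-↭ as i) S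
  ... | g ∷ S′ = λ c → subst (λ u → Linked Compatible (_ ∷ u)) (sym (++-assoc (block _ a) (people ℓ) L))
                   (block-follows g a (people-follows S′ T ℓ l) c)
  people-follows {s} {cs} S T (turn i ℓ) l c =
    calm-compatible c (spouse-calm s _) ∷ spouse-compatible s _ ∷
    people-follows T (subst (λ t → Sexed t _) (sym (other-involutive s)) S) ℓ
      (subst (λ k → Follows (others s k) _) (length-removeAt′ cs i) l) (spouse-calm (other s) _)

  contiguous-++ : ∀ {h b L} → All (InGroup h) b → All (∁ (InGroup h)) L →
    (∀ g → Contiguous (InGroup g) L) → ∀ g → Contiguous (InGroup g) (b ++ L)
  contiguous-++ {h} yes-b no-L c g with g ≟ᴳ h
  ... | yes refl = start (Run-++ yes-b (stop no-L))
  ... | no g≢h   = Contiguous-++ (All.map (λ e e′ → g≢h (trans (sym e′) e)) yes-b) (c g)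

  people-contiguous : ∀ {s cs as bs} → Unique (groups cs as bs) → (ℓ : Line s cs as bs) →
    ∀ g → Contiguous (InGroup g) (people ℓ)
  people-contiguous U done g = start (stop [])
  people-contiguous {s} {cs} {as} {bs} U (item i a ℓ) =
    let U′ = Unique-resp-↭ (groups-item cs as bs i) U
    in contiguous-++ (block-group _ a) (outside U′ (people-↭ ℓ)) (people-contiguous (Unique-tail U′) ℓ)
  people-contiguous {s} {cs} {as} {bs} U (turn i ℓ) =
    let U′ = Unique-resp-↭ (groups-couple cs as bs i) U
    in contiguous-++ (spouse-group s _ ∷ spouse-group (other s) _ ∷ [])
         (outside U′ (people-↭ ℓ)) (people-contiguous (Unique-tail U′) ℓ)

  -- The person `z` ending the block is again calm and in `g`, which is exactly what is needed to
  -- read the next block. A polygamous family is entered through a wife, as its husband is not calm.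
  read-item : ∀ {s g p y R L} → OfSex s g → Calm s p → p ∈ members g →
    p ∷ L ↭ members g ++ R → All (∁ (InGroup g)) R → (∀ f → Contiguous (InGroup (fam f)) (p ∷ L)) →
    groupOf y ≢ g → Linked Compatible (p ∷ L ++ y ∷ []) →
    Σ (Arrangement g) λ a → Reading {P = InGroup g} {λ z → Calm s z × groupOf z ≡ g} {Compatible} {y} (p ∷ L) (block g a) R
  read-item {L = L} man♂   c (here refl) e out k ne l = tt , L , _ , refl , drop-∷ e , (singleMan , refl) , l
  read-item {L = L} woman♀ c (here refl) e out k ne l = tt , L , _ , refl , drop-∷ e , (singleWoman , refl) , l
  read-item (fam♀ _) () (here refl)
  read-item {p = p} {R = R} {L} (fam♀ {f} 1<) c (there p∈) e out k ne l =
    let p∈f = ∈-members⁻ (fam f) (there p∈)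
        e′  = drop-∷ (↭-trans e (↭-trans (prep _ (++⁺ʳ R (remove-∈-↭ p∈))) (swap _ _ ↭-refl)))
        vs  = All.tail (All-resp-↭ (remove-∈-↭ p∈) (wivesOf-wives f))
        φ , u , z , eq , rest = read-followed {Q = λ z → Calm ♀ z × groupOf z ≡ fam f} L
          (λ { ((_ , t) , _) → wife-group (t f 1< refl) }) e′ (Contiguous-head p∈f (k f))
          refl (All.map wife-group vs) out ne (All.map (λ { v@(wife _ _) → wife , refl }) vs) l
    in (Any.index p∈ , φ) , u , z , cong₂ _∷_ (lookup-index p∈) eq , rest

  -- Here `x` is the calm person just passed and `y` the first person of the circle, who closes it.
  -- The bound `k` drives the recursion, because the rest `u` is only known through an equation
  -- `L ≡ b ++ u` and is not a subterm.
  read-line : ∀ k {s cs as bs x y} L → length L ≤ k → Sexed s as → Sexed (other s) bs →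
    Calm s x → Unique (groupOf x ∷ groups cs as bs) → All (groupOf y ≢_) (as ++ bs) →
    L ↭ concatMap members (groups cs as bs) → Linked Compatible (x ∷ L ++ y ∷ []) →
    (∀ f → Contiguous (InGroup (fam f)) L) → ∃ λ (ℓ : Line s cs as bs) → people ℓ ≡ L
  -- Every group has a member, so an empty list of people leaves no group.
  read-line _ {cs = cs} {as} {bs} [] _ S T c U ne e l k with groups cs as bs in eq | ↭-empty-inv (↭-sym e)
  read-line _ {cs = []} {[]} {[]} [] _ S T c U ne e l k | [] | _ = done , refl
  read-line _ [] _ S T c U ne e l k | fam _ ∷ _ | ()
  read-line _ [] _ S T c U ne e l k | man _ ∷ _ | ()
  read-line _ [] _ S T c U ne e l k | woman _ ∷ _ | ()
  read-line (suc n₀) {s} {cs} {as} {bs} {x} {y} (p ∷ L) (s≤s L≤) S T c U ne e (ok ∷ l) k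
    with g , g∈ , p∈ ← find (∈-concatMap⁻ members (∈-resp-↭ e (here refl)))
    -- The group of `x` is already used up, so `p` comes from another group and inherits calmness
    -- and sex.
    with p-calm ← compatible-calm c ok (λ q → All.lookup (outside U e) (here refl) (sym q))
    with ∈-++⁻ (map pair cs) g∈
  -- A calm person of sex `s` in a couple is its spouse of sex `s`; contiguity puts the other spouse
  -- next, and the roles of the sexes swap.
  ... | inj₁ g∈cs with _ , c∈ , refl ← ∈-map⁻ pair g∈cs
                  with i , refl ← index-of c∈
                  with refl ← calm-spouse s p-calm p∈ =
    let gs = groups-couple cs as bs i
        U′ = Unique-resp-↭ gs (Unique-tail U)
        q = spouse (other s) (lookup cs i)
        p-group = spouse-group s (lookup cs i)
        q-group = spouse-group (other s) (lookup cs i)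
        R↭ = ↭-trans e (↭-trans (concatMap-↭ members gs) (++⁺ʳ _ (↭-sym (spouses-↭ s (lookup cs i)))))
        u , eq , u↭ = read-one L (drop-∷ R↭) (Contiguous-head p-group (k _)) q-group (outside U′ ↭-refl)
        l′ = Linked-tail (subst (λ v → Linked Compatible (p ∷ v ++ y ∷ [])) eq l)
        ℓ , eq′ = read-line n₀ u (≤-trans (m≤n+m _ 1) (subst (λ v → length v ≤ n₀) eq L≤)) T
          (subst (λ t → Sexed t as) (sym (other-involutive s)) S)
          (spouse-calm (other s) _) (subst (λ h → Unique (h ∷ _)) (sym q-group) U′)
          (All-resp-↭ (++-comm as bs) ne) u↭ l′
          (λ h → Contiguous-++ʳ (p ∷ q ∷ []) (subst (λ v → Contiguous _ (p ∷ v)) eq (k h)))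
    in turn i ℓ , cong (p ∷_) (trans (cong (q ∷_) eq′) (sym eq))
  ... | inj₂ g∈ab with ∈-++⁻ as g∈ab
  -- A group of the other sex cannot begin with a calm person of sex `s`.
  ...   | inj₂ g∈bs = contradiction (calm-sex (All.lookup T g∈bs) p∈ p-calm) (other-≢ s)
  ...   | inj₁ g∈as with i , refl ← index-of g∈as =
    let gs = groups-item cs as bs i
        U′ = Unique-resp-↭ gs (Unique-tail U)
        S′ = All-resp-↭ (remove-↭ as i) S
        ne′ = All-resp-↭ (++⁺ʳ bs (remove-↭ as i)) ne
        a , u , z , eq , u↭ , (z-calm , z-group) , l′ = read-item (All.head S′) p-calm p∈
          (↭-trans e (concatMap-↭ members gs)) (outside U′ ↭-refl) k (All.head ne′) l
        _ , v , eqb = block-≢[] _ a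
        ℓ , eq′ = read-line n₀ u (shorter v (trans eq (cong (_++ u) eqb))) (All.tail S′) T z-calm
          (subst (λ h → Unique (h ∷ _)) (sym z-group) U′) (All.tail ne′) u↭ l′
          (λ h → Contiguous-++ʳ (block _ a) (subst (Contiguous _) eq (k h)))
    in item i a ℓ , trans (cong (block _ a ++_) eq′) (sym eq)
    where
    shorter : ∀ {q u} v → p ∷ L ≡ q ∷ v ++ u → length u ≤ n₀
    shorter {u = u} v refl = ≤-trans (m≤n+m (length u) (length v)) (subst (_≤ n₀) (length-++ v) L≤)

-- The recurrence for lines and its solution.

-- The number of lines with c couples, a groups of the current sex and b groups of
-- the other sex still to come, if every group had only one internal arrangement.

lines : ℕ → ℕ → ℕ → ℕ
lines zero    zero    zero    = 1
lines zero    zero    (suc b) = 0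
lines zero    (suc a) b       = suc a * lines zero a b
lines (suc c) zero    b       = suc c * lines c b zero
lines (suc c) (suc a) b       = suc a * lines (suc c) a b + suc c * lines c b (suc a)

-- Built from successors so that the clauses of `lines` compute on it.
double : ℕ → ℕ
double zero    = zero
double (suc q) = suc (suc (double q))

double-* : ∀ q → double q ≡ q * 2
double-* zero    = refl
double-* (suc q) = cong (2 +_) (double-* q)

lines-zero : ∀ a → lines 0 a 0 ≡ a !
lines-zero zero    = refl
lines-zero (suc a) = cong (suc a *_) (lines-zero a)

lines-one : ∀ a b → lines 1 a b ≡ a ! * b !
lines-one zero    b = cong (_+ 0) (lines-zero b)
lines-one (suc a) b = trans (cong₂ _+_ (cong (suc a *_) (lines-one a b)) (cong (_+ 0) (vanish b)))
                            (ring (suc a) (a !) (b !))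
  where
  -- Without a couple the sexes never swap again, so groups of the other sex cannot be placed.
  vanish : ∀ b → lines 0 b (suc a) ≡ 0
  vanish zero    = refl
  vanish (suc b) = trans (cong (suc b *_) (vanish b)) (*-zeroʳ (suc b))
  ring : ∀ x y z → x * (y * z) + 0 ≡ x * y * z
  ring = solve-∀

-- The `2 q + 1` couples create `q + 1` runs of either sex, whence `(a + q) ! / q !` and
-- `(b + q) ! / q !`. Denominators are cleared to stay within `ℕ`.
lines-odd : ∀ q a b → lines (suc (double q)) a b * (q ! * q !) ≡ (a + q) ! * (b + q) ! * suc (double q) !

-- With `2 q + 2` couples the line begins and ends in the current sex, which has `q + 2` runs
-- against `q + 1` of the other. A turn leads from each parity to the other, hence the mutual
-- induction.
lines-even : ∀ q a b → lines (double (suc q)) a b * (suc q ! * q !) ≡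
             (a + suc q) ! * (b + q) ! * double (suc q) !

lines-odd zero a b = trans (*-identityʳ _) (trans (lines-one a b)
  (sym (trans (*-identityʳ _) (cong₂ (λ x y → x ! * y !) (+-identityʳ a) (+-identityʳ b)))))
lines-odd (suc q) zero b = trans (ring₁ (suc D) E (suc q) (q !)) (trans
  (cong (suc D * suc q *_) (lines-even q b 0)) (ring₂ (suc D) (suc q) ((b + suc q) !) (q !) (D !)))
  where
  D = double (suc q)
  E = lines D b 0
  ring₁ : ∀ d e s f → d * e * (s * f * (s * f)) ≡ d * s * (e * (s * f * f))
  ring₁ = solve-∀
  ring₂ : ∀ d s g f h → d * s * (g * f * h) ≡ s * f * g * (d * h)
  ring₂ = solve-∀
-- Both branches carry `suc (a + q) !`; their weights `suc a` and `suc q` add up to the next factor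
-- of the larger factorial. The even case runs the same way.
lines-odd (suc q) (suc a) b = trans (ring₁ (suc a) (lines (suc D) a b) (suc D) E (suc q) (q !)) (trans
  (cong₂ (λ x y → suc a * x + suc D * suc q * y) (lines-odd (suc q) a b) (lines-even q b (suc a)))
  (trans (cong (λ x → suc a * (x ! * G * suc D !) + suc D * suc q * (G * suc (a + q) ! * D !)) (+-suc a q))
  (trans (ring₂ (suc a) (suc (a + q) !) G (suc D) (D !) (suc q))
    (cong (λ x → (suc a + suc q) * x ! * G * suc D !) (sym (+-suc a q))))))
  where
  D = double (suc q)
  E = lines D b (suc a)
  G = (b + suc q) !
  ring₁ : ∀ a x d e s f → (a * x + d * e) * (s * f * (s * f)) ≡
          a * (x * (s * f * (s * f))) + d * s * (e * (s * f * f))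
  ring₁ = solve-∀
  ring₂ : ∀ a x y d z s → a * (x * y * (d * z)) + d * s * (y * x * z) ≡ (a + s) * x * y * (d * z)
  ring₂ = solve-∀

lines-even q zero b = trans (ring₁ D (lines (suc (double q)) b 0) (suc q) (q !)) (trans
  (cong (D * suc q *_) (lines-odd q b 0)) (ring₂ D (suc q) ((b + q) !) (q !) (suc (double q) !)))
  where
  D = double (suc q)
  ring₁ : ∀ d e s f → d * e * (s * f * f) ≡ d * s * (e * (f * f))
  ring₁ = solve-∀
  ring₂ : ∀ d s g f h → d * s * (g * f * h) ≡ s * f * g * (d * h)
  ring₂ = solve-∀
lines-even q (suc a) b = trans (ring₁ (suc a) (lines D a b) D (lines (suc (double q)) b (suc a)) (suc q) (q !)) (trans
  (cong₂ (λ x y → suc a * x + D * suc q * y) (lines-even q a b) (lines-odd q b (suc a)))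
  (trans (cong (λ x → suc a * (x ! * G * D !) + D * suc q * (G * suc (a + q) ! * suc (double q) !)) (+-suc a q))
  (trans (ring₂ (suc a) (suc (a + q) !) G D (suc (double q) !) (suc q))
    (cong (λ x → (suc a + suc q) * x ! * G * D !) (sym (+-suc a q))))))
  where
  D = double (suc q)
  G = (b + q) !
  ring₁ : ∀ a x d e s f → (a * x + d * e) * (s * f * f) ≡
          a * (x * (s * f * f)) + d * s * (e * (f * f))
  ring₁ = solve-∀
  ring₂ : ∀ a x y d z s → a * (x * y * (d * z)) + d * s * (y * x * z) ≡ (a + s) * x * y * (d * z)
  ring₂ = solve-∀

-- An odd number of couples gives both sexes the same number of runs, so the closed form is
-- symmetric.
lines-comm : ∀ q a b → lines (suc (double q)) a b ≡ lines (suc (double q)) b a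
lines-comm q a b = *-cancelʳ-≡ _ _ (q ! * q !) {{q !* q !≢0}}
  (trans (lines-odd q a b) (trans (cong (_* suc (double q) !) (*-comm ((a + q) !) _)) (sym (lines-odd q b a))))

-- Both divisions are exact: for `k = 2 q + 2` the first quotient times `q !` is twice
-- `(2 q + 1) !`, and the second times `q !` is `(m + q) !`.
lines-quotients : ∀ {k} q m s → k ≡ suc q * 2 →
  2 * lines (suc (double q)) m s ≡
    (_/_ (k !) ((k / 2) !) {{(k / 2) !≢0}}) *
    (_/_ ((k / 2 + m ∸ 1) !) ((k / 2 ∸ 1) !) {{(k / 2 ∸ 1) !≢0}}) * (s + q) !
lines-quotients q m s refl rewrite m*n/n≡m (suc q) 2 ⦃ _ ⦄ =
  *-cancelʳ-≡ _ _ (q ! * q !) {{q !* q !≢0}} (begin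
    2 * lines D m s * (q ! * q !)             ≡⟨ *-assoc 2 (lines D m s) _ ⟩
    2 * (lines D m s * (q ! * q !))           ≡⟨ cong (2 *_) (lines-odd q m s) ⟩
    2 * ((m + q) ! * (s + q) ! * D !)         ≡⟨ ring₁ ((m + q) !) ((s + q) !) (D !) ⟩
    2 * D ! * (m + q) ! * (s + q) !           ≡⟨ cong₂ (λ x y → x * y * (s + q) !) X-eq Y-eq ⟨
    X * q ! * (Y * q !) * (s + q) !           ≡⟨ ring₂ X (q !) Y ((s + q) !) ⟩
    X * Y * (s + q) ! * (q ! * q !)           ∎)
  where
  open ≡-Reasoning
  D = suc (double q)
  X = _/_ ((suc q * 2) !) (suc q !) {{suc q !≢0}}
  Y = _/_ ((q + m) !) (q !) {{q !≢0}}
  ring₁ : ∀ x y z → 2 * (x * y * z) ≡ 2 * z * x * y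
  ring₁ = solve-∀
  ring₂ : ∀ x f y z → x * f * (y * f) * z ≡ x * y * z * (f * f)
  ring₂ = solve-∀
  ring₃ : ∀ x s f → x * f * s ≡ x * (s * f)
  ring₃ = solve-∀
  ring₄ : ∀ s d → s * 2 * d ≡ 2 * d * s
  ring₄ = solve-∀
  Y-eq : Y * q ! ≡ (m + q) !
  Y-eq = trans (m/n*n≡m {{q !≢0}} (m≤n⇒m!∣n! (m≤m+n q m))) (cong _! (+-comm q m))
  X-eq : X * q ! ≡ 2 * D !
  X-eq = *-cancelʳ-≡ _ _ (suc q) (begin
    X * q ! * suc q       ≡⟨ ring₃ X (suc q) (q !) ⟩
    X * suc q !           ≡⟨ m/n*n≡m {{suc q !≢0}} (m≤n⇒m!∣n! (m≤m*n (suc q) 2)) ⟩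
    (suc q * 2) !         ≡⟨ cong (λ x → suc (suc q * 2 ∸ 1) * x !) (cong suc (double-* q)) ⟨
    suc q * 2 * D !       ≡⟨ ring₄ (suc q) (D !) ⟩
    2 * D ! * suc q       ∎)

-- The cardinality of the type of lines.

module Counting (r : ℕ) (n : ℕ → ℕ) (m w : ℕ) (2≤r : 2 ≤ r) where
  open Rounds r n m w 2≤r

  arrangements : Group → ℕ
  arrangements (fam f)   = (wives f ∸ 1) * wives f !
  arrangements (man _)   = 1
  arrangements (woman _) = 1

  weight : List Group → ℕ
  weight gs = product (map arrangements gs)

  weight-removeAt : ∀ gs i → weight gs ≡ arrangements (lookup gs i) * weight (removeAt gs i)
  weight-removeAt gs i = product-↭ (map⁺ arrangements (remove-↭ gs i))

  -- With `v` wives there are `v` choices of the first one and `(v ∸ 1) * (v ∸ 1) !` continuations;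
  -- for a family of size `k` the product is `(k ∸ 2) * (k ∸ 1) !`.
  Arrangement-size : ∀ g → Arrangement g ↔ Fin (arrangements g)
  Arrangement-size (fam f)   = resize (trans (closed (length (wivesOf f))) (cong (λ k → (k ∸ 1) * k !)
                                        (trans (length-map (wife f) (allFin (wives f))) (length-tabulate {n = wives f} id))))
    (Σ-size (λ i → Followed-size _ (length-removeAt (wivesOf f) i)))
    where
    ring : ∀ k x → suc k * (k * x) ≡ k * (suc k * x)
    ring = solve-∀
    closed : ∀ k → k * (pred k * pred k !) ≡ (k ∸ 1) * k !
    closed zero    = refl
    closed (suc k) = ring k (k !)
  Arrangement-size (man _)   = mk↔ₛ′ (λ _ → zero) (λ _ → tt) (λ { zero → refl }) (λ _ → refl)
  Arrangement-size (woman _) = mk↔ₛ′ (λ _ → zero) (λ _ → tt) (λ { zero → refl }) (λ _ → refl)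

  ItemFirst TurnFirst : Sex → List (Fin (n 2)) → List Group → List Group → Set
  ItemFirst s cs as bs = Σ (Fin (length as)) λ i → Arrangement (lookup as i) × Line s cs (removeAt as i) bs
  TurnFirst s cs as bs = Σ (Fin (length cs)) λ i → Line (other s) (removeAt cs i) bs as

  Line-cases : ∀ {s cs as bs} → 0 < length as + length cs →
    Line s cs as bs ↔ (ItemFirst s cs as bs ⊎ TurnFirst s cs as bs)
  Line-cases {s} 0< = mk↔ₛ′ (to 0<) from
    (λ { (inj₁ _) → refl ; (inj₂ _) → refl }) (from-to 0<)
    where
    to : ∀ {cs as bs} → 0 < length as + length cs → Line s cs as bs → ItemFirst s cs as bs ⊎ TurnFirst s cs as bs
    to 0< (item i a ℓ) = inj₁ (i , a , ℓ)
    to 0< (turn i ℓ)   = inj₂ (i , ℓ)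
    from : ∀ {cs as bs} → ItemFirst s cs as bs ⊎ TurnFirst s cs as bs → Line s cs as bs
    from (inj₁ (i , a , ℓ)) = item i a ℓ
    from (inj₂ (i , ℓ))     = turn i ℓ
    from-to : ∀ {cs as bs} (0< : 0 < length as + length cs) (ℓ : Line s cs as bs) → from (to 0< ℓ) ≡ ℓ
    from-to 0< (item i a ℓ) = refl
    from-to 0< (turn i ℓ)   = refl

  module _ {s : Sex} {cs : List (Fin (n 2))} {as bs : List Group} where

    ItemFirst-size : ∀ {k} → (∀ i → Line s cs (removeAt as i) bs ↔ Fin (weight (removeAt as i) * weight bs * k)) →
      ItemFirst s cs as bs ↔ Fin (length as * (weight as * weight bs * k))
    ItemFirst-size {k} f = Σ-size λ i → resize
      (trans (ring (arrangements (lookup as i)) (weight (removeAt as i)) (weight bs) k) (cong (λ x → x * weight bs * k) (sym (weight-removeAt as i))))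
      (×-size (Arrangement-size (lookup as i)) (f i))
      where
      ring : ∀ x y z u → x * (y * z * u) ≡ x * y * z * u
      ring = solve-∀

    -- The product of the internal arrangements does not depend on which group comes first, so it
    -- factors out and leaves the recurrence of `lines`.
    Line-size-step : ∀ {c a j k} → length cs ≡ c → length as ≡ a → 0 < a + c →
      (∀ i → Line s cs (removeAt as i) bs ↔ Fin (weight (removeAt as i) * weight bs * j)) →
      (∀ i → Line (other s) (removeAt cs i) bs as ↔ Fin (weight bs * weight as * k)) →
      Line s cs as bs ↔ Fin (weight as * weight bs * (a * j + c * k))
    Line-size-step {c} {a} {j} {k} refl refl 0< f g = resize (ring a c (weight as) (weight bs) j k)
      (↔-trans (Line-cases 0<) (⊎-size (ItemFirst-size f) (Σ-size g)))
      where
      ring : ∀ a c v u j k → a * (v * u * j) + c * (u * v * k) ≡ v * u * (a * j + c * k)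
      ring = solve-∀

  Line-size : ∀ c a {s} cs as bs → length cs ≡ c → length as ≡ a →
    Line s cs as bs ↔ Fin (weight as * weight bs * lines c a (length bs))
  Line-size zero zero [] [] []       refl refl =
    mk↔ₛ′ (λ _ → zero) (λ _ → done) (λ { zero → refl }) (λ { done → refl ; (item () _ _) ; (turn () _) })
  Line-size zero zero [] [] (g ∷ bs) refl refl = resize (sym (*-zeroʳ (1 * weight (g ∷ bs))))
    (mk↔ₛ′ (λ { (item () _ _) ; (turn () _) }) (λ ()) (λ ()) (λ { (item () _ _) ; (turn () _) }))
  Line-size zero (suc a) [] as bs eqc eqa =
    -- No couple is left, so `k` is a placeholder multiplied by zero.
    resize (cong (weight as * weight bs *_) (+-identityʳ _)) (Line-size-step {k = 0} eqc eqa (s≤s z≤n)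
      (λ i → Line-size zero a [] (removeAt as i) bs eqc (removed as i eqa)) (λ ()))
    where
    removed : ∀ (xs : List Group) {a} i → length xs ≡ suc a → length (removeAt xs i) ≡ a
    removed xs i e = trans (length-removeAt xs i) (cong pred e)
  -- No group of the current sex is left, so `j` is a placeholder multiplied by zero.
  Line-size (suc c) zero cs [] bs eqc eqa = Line-size-step {j = 0} eqc eqa (s≤s z≤n) (λ ())
    (λ i → Line-size c (length bs) (removeAt cs i) bs [] (trans (length-removeAt cs i) (cong pred eqc)) refl)
  Line-size (suc c) (suc a) {s} cs as bs eqc eqa = Line-size-step eqc eqa (s≤s z≤n)
    (λ i → Line-size (suc c) a cs (removeAt as i) bs eqc (trans (length-removeAt as i) (cong pred eqa)))
    (λ i → subst (λ l → Line (other s) (removeAt cs i) bs as ↔ Fin (weight bs * weight as * lines c (length bs) l)) eqa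
      (Line-size c (length bs) (removeAt cs i) bs as (trans (length-removeAt cs i) (cong pred eqc)) refl))

-- Sums and products over enumerated groups.

module _ (F : List ℕ → ℕ) (_∙_ : ℕ → ℕ → ℕ)
  (F-∷ : ∀ x xs → F (x ∷ xs) ≡ x ∙ F xs) (F-++ : ∀ xs ys → F (xs ++ ys) ≡ F xs ∙ F ys) where

  -- Serves for `sum` (numbers of groups and people) and for `product` (arrangements) alike,
  -- bringing an enumeration by size and index into the `applyUpTo` form behind `Σ[_⋯_]` and
  -- `Π[_⋯_]`.
  fold-concat-tabulate : ∀ (h : A → ℕ) k (e : Fin k → List A) (c : ℕ → ℕ) →
    (∀ j → F (map h (e j)) ≡ c (toℕ j)) → F (map h (concat (tabulate e))) ≡ F (applyUpTo c k)
  fold-concat-tabulate h zero    e c eq = refl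
  fold-concat-tabulate h (suc k) e c eq = trans
    (trans (cong F (map-++ h (e zero) _)) (F-++ (map h (e zero)) _))
    (trans (cong₂ _∙_ (eq zero) (fold-concat-tabulate h k (e ∘ suc) (c ∘ suc) (eq ∘ suc)))
           (sym (F-∷ _ _)))

sum-tabulate : ∀ (h : A → ℕ) k (e : Fin k → A) {c} → (∀ i → h (e i) ≡ c) → sum (map h (tabulate e)) ≡ k * c
sum-tabulate h zero    e eq = refl
sum-tabulate h (suc k) e eq = cong₂ _+_ (eq zero) (sum-tabulate h k (e ∘ suc) (eq ∘ suc))

product-tabulate : ∀ (h : A → ℕ) k (e : Fin k → A) {c} → (∀ i → h (e i) ≡ c) → product (map h (tabulate e)) ≡ c ^ k
product-tabulate h zero    e eq = refl
product-tabulate h (suc k) e eq = cong₂ _*_ (eq zero) (product-tabulate h k (e ∘ suc) (eq ∘ suc))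

length-sum : ∀ (xs : List A) → length xs ≡ sum (map (const 1) xs)
length-sum []       = refl
length-sum (x ∷ xs) = cong suc (length-sum xs)

length-concatMap : ∀ {B : Set} (f : A → List B) xs → length (concatMap f xs) ≡ sum (map (length ∘ f) xs)
length-concatMap f []       = refl
length-concatMap f (x ∷ xs) = trans (length-++ (f x)) (cong (length (f x) +_) (length-concatMap f xs))

-- The complete lists of groups and of people.

module Everyone (r′ : ℕ) (n : ℕ → ℕ) (m w : ℕ) where

  private
    r : ℕ
    r = 2 + r′
    P : Set
    P = Person r n m w

  2≤r : 2 ≤ r
  2≤r = s≤s (s≤s z≤n)

  open Rounds r n m w 2≤r
  open Counting r n m w 2≤r

  -- Sizes are written `3 + toℕ j` so that they run through 3 to `r` with the indexing of
  -- `Σ[ 3 ⋯ r ]`.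
  polygamous : (j : Fin r′) → Fin (n (3 + toℕ j)) → Group
  polygamous j i = fam (family (3 + toℕ j) (s≤s (s≤s z≤n)) (s≤s (s≤s (toℕ<n j))) i)

  polygamousGroups : List Group
  polygamousGroups = concat (tabulate λ j → tabulate (polygamous j))

  items : Sex → List Group
  items ♂ = tabulate man
  items ♀ = tabulate woman ++ polygamousGroups

  allGroups : Sex → List Group
  allGroups s = groups (allFin (n 2)) (items s) (items (other s))

  allGroups-↭ : ∀ s → allGroups ♀ ↭ allGroups s
  allGroups-↭ ♂ = ++⁺ˡ (map pair (allFin (n 2))) (++-comm (items ♀) (items ♂))
  allGroups-↭ ♀ = ↭-refl

  ∈-polygamous⁻ : ∀ {g} → g ∈ polygamousGroups → ∃ λ j → ∃ λ i → g ≡ polygamous j i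
  ∈-polygamous⁻ g∈ with _ , g∈xs , xs∈ ← ∈-concat⁻′ (tabulate λ j → tabulate (polygamous j)) g∈
                   with j , refl ← ∈-tabulate⁻ xs∈
                   with i , refl ← ∈-tabulate⁻ g∈xs = j , i , refl

  ∈-items⁻ : ∀ {s g} → g ∈ items s → OfSex s g
  ∈-items⁻ {♂} g∈ with _ , refl ← ∈-tabulate⁻ g∈ = man♂
  ∈-items⁻ {♀} g∈ with ∈-++⁻ (tabulate woman) g∈
  ... | inj₁ g∈′ with _ , refl ← ∈-tabulate⁻ g∈′ = woman♀
  ... | inj₂ g∈′ with _ , _ , refl ← ∈-polygamous⁻ g∈′ = fam♀ (s≤s (s≤s z≤n))

  items-sexed : ∀ s → Sexed s (items s)
  items-sexed s = All.tabulate ∈-items⁻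

  ∈-polygamous : ∀ {k} (j : Fin r′) → toℕ j ≡ k → .(p : 2 ≤ 3 + k) .(q : 3 + k ≤ r) (i : Fin (n (3 + k))) →
    fam (family (3 + k) p q i) ∈ polygamousGroups
  ∈-polygamous j refl p q i = ∈-concat⁺′ {v = polygamous j i} (∈-tabulate⁺ i)
                                (∈-tabulate⁺ {f = λ j → tabulate (polygamous j)} j)

  ∈-allGroups : ∀ s g → g ∈ allGroups s
  ∈-allGroups s g = ∈-resp-↭ (allGroups-↭ s) (∈♀ g)
    where
    ∈-families : ∀ k (p : 2 ≤ k) (q : k ≤ r) (i : Fin (n k)) → fam (family k p q i) ∈ allGroups ♀
    ∈-families (suc zero)          (s≤s ()) q i
    ∈-families (suc (suc zero))    p q i = ∈-++⁺ˡ (∈-map⁺ pair (∈-allFin i))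
    ∈-families (suc (suc (suc k))) p q@(s≤s (s≤s k<r′)) i =
      ∈-++⁺ʳ (map pair (allFin (n 2))) (∈-++⁺ˡ (∈-++⁺ʳ (tabulate woman)
        (∈-polygamous (fromℕ< k<r′) (toℕ-fromℕ< k<r′) p q i)))
    ∈♀ : ∀ g → g ∈ allGroups ♀
    -- The bounds stored in a family are irrelevant; deciding them again yields proofs that can be
    -- matched on.
    ∈♀ (fam (family k p q i)) = ∈-families k (recompute (2 ≤? k) p) (recompute (k ≤? r) q) i
    ∈♀ (man i)   = ∈-++⁺ʳ (map pair (allFin (n 2))) (∈-++⁺ʳ (items ♀) (∈-tabulate⁺ i))
    ∈♀ (woman i) = ∈-++⁺ʳ (map pair (allFin (n 2))) (∈-++⁺ˡ (∈-++⁺ˡ (∈-tabulate⁺ i)))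

  polygamous-Unique : Unique polygamousGroups
  polygamous-Unique = Unique.concat⁺
    (All.tabulate⁺ λ j → Unique.tabulate⁺ λ { refl → refl })
    (AllPairs.tabulate⁺ λ {i} {j} i≢j (g∈ , g∈′) → i≢j (same (∈-tabulate⁻ g∈) (∈-tabulate⁻ g∈′)))
    where
    same : ∀ {i j g} → (∃ λ k → g ≡ polygamous i k) → (∃ λ k → g ≡ polygamous j k) → i ≡ j
    same (_ , refl) (_ , eq) = toℕ-injective (+-cancelˡ-≡ 3 _ _ (cong groupSize eq))
      where
      groupSize : Group → ℕ
      groupSize (fam f)   = size f
      groupSize (man _)   = 1
      groupSize (woman _) = 1

  allGroups-Unique : ∀ s → Unique (allGroups s)
  allGroups-Unique s = Unique-resp-↭ (allGroups-↭ s) $ Unique.++⁺ (Unique.map⁺ (λ { refl → refl }) (Unique.allFin⁺ (n 2)))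
    (Unique.++⁺ (Unique.++⁺ (Unique.tabulate⁺ λ { refl → refl }) polygamous-Unique
                  (λ (a , b) → woman≢ (∈-tabulate⁻ a) (∈-polygamous⁻ b)))
                (Unique.tabulate⁺ λ { refl → refl })
                (λ (a , b) → contradiction (sexes (∈-items⁻ {♀} a) (∈-items⁻ {♂} b)) λ ()))
    (λ (a , b) → pair≢ (∈-map⁻ pair a) (∈-++⁻ (items ♀) b))
    where
    woman≢ : ∀ {g} → (∃ λ i → g ≡ woman i) → ¬ ∃ λ j → ∃ λ k → g ≡ polygamous j k
    woman≢ (_ , refl) (_ , _ , ())
    sexes : ∀ {s t g} → OfSex s g → OfSex t g → s ≡ t
    sexes man♂     man♂     = refl
    sexes woman♀   woman♀   = refl
    sexes (fam♀ _) (fam♀ _) = refl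
    not-pair : ∀ {s c} → ¬ OfSex s (pair c)
    not-pair (fam♀ (s≤s ()))
    pair≢ : ∀ {g} → (∃ λ c → c ∈ allFin (n 2) × g ≡ pair c) → ¬ (g ∈ items ♀ ⊎ g ∈ items ♂)
    pair≢ (_ , _ , refl) (inj₁ g∈) = not-pair (∈-items⁻ {♀} g∈)
    pair≢ (_ , _ , refl) (inj₂ g∈) = not-pair (∈-items⁻ {♂} g∈)

  everyone : Sex → List P
  everyone s = concatMap members (allGroups s)

  ∈-everyone : ∀ s p → p ∈ everyone s
  ∈-everyone s p = ∈-concatMap⁺ members (Any.map (λ { refl → ∈-members p }) (∈-allGroups s (groupOf p)))

  everyone-Unique : ∀ s → Unique (everyone s)
  everyone-Unique s = go (allGroups-Unique s)
    where
    go : ∀ {gs} → Unique gs → Unique (concatMap members gs)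
    go []            = []
    go {g ∷ gs} U@(_ ∷ U′) = Unique.++⁺ (members-Unique g) (go U′)
      (λ (a , b) → All.lookup (outside U ↭-refl) b (∈-members⁻ g a))

  length-items-♂ : length (items ♂) ≡ m
  length-items-♂ = length-tabulate man

  length-items-♀ : length (items ♀) ≡ w + Σ[ 3 ⋯ r ] n
  length-items-♀ = trans (length-++ (tabulate woman)) (cong₂ _+_ (length-tabulate woman)
    (trans (length-sum polygamousGroups)
      (fold-concat-tabulate sum _+_ (λ _ _ → refl) sum-++ (const 1) r′ _ (λ i → n (3 + i))
        (λ j → trans (sum-tabulate (const 1) (n (3 + toℕ j)) (polygamous j) (λ _ → refl)) (*-identityʳ _)))))

  weight-items-♂ : weight (items ♂) ≡ 1
  weight-items-♂ = trans (product-tabulate arrangements m man (λ _ → refl)) (^-zeroˡ m)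

  weight-items-♀ : weight (items ♀) ≡ Π[ 3 ⋯ r ] (λ k → ((k ∸ 2) * (k ∸ 1) !) ^ n k)
  weight-items-♀ = begin
    product (map arrangements (items ♀))  ≡⟨ cong product (map-++ arrangements (tabulate woman) _) ⟩
    product (map arrangements (tabulate woman) ++ map arrangements polygamousGroups)
                                          ≡⟨ product-++ (map arrangements (tabulate woman)) _ ⟩
    product (map arrangements (tabulate woman)) * weight polygamousGroups
      ≡⟨ cong (_* weight polygamousGroups)
          (trans (product-tabulate arrangements w woman (λ _ → refl)) (^-zeroˡ w)) ⟩
    1 * weight polygamousGroups           ≡⟨ *-identityˡ _ ⟩
    weight polygamousGroups
      ≡⟨ fold-concat-tabulate product _*_ (λ _ _ → refl) product-++ arrangements r′ _ _
          (λ j → product-tabulate arrangements (n (3 + toℕ j)) (polygamous j) (λ _ → refl)) ⟩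
    Π[ 3 ⋯ r ] (λ k → ((k ∸ 2) * (k ∸ 1) !) ^ n k)  ∎
    where open ≡-Reasoning

  length-everyone : ∀ s → length (everyone s) ≡ persons r n m w
  length-everyone s = begin
    length (everyone s)  ≡⟨ ↭-length (concatMap-↭ members (allGroups-↭ s)) ⟨
    length (everyone ♀)  ≡⟨ length-concatMap members (allGroups ♀) ⟩
    sum (map size′ (map pair (allFin (n 2)) ++ items ♀ ++ items ♂))
      ≡⟨ cong (λ gs → sum (map size′ (gs ++ items ♀ ++ items ♂))) (map-tabulate id pair) ⟩
    sum (map size′ (tabulate pair ++ (tabulate woman ++ polygamousGroups) ++ tabulate man))
      ≡⟨ split (tabulate pair) _ ⟩
    S (tabulate pair) + S ((tabulate woman ++ polygamousGroups) ++ tabulate man)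
      ≡⟨ cong (S (tabulate pair) +_) (trans (split (items ♀) _) (cong (_+ S (items ♂)) (split (tabulate woman) _))) ⟩
    S (tabulate pair) + (S (tabulate woman) + S polygamousGroups + S (tabulate man))
      ≡⟨ cong₂ _+_ (sum-tabulate size′ (n 2) pair (λ _ → refl))
           (cong₂ _+_ (cong₂ _+_ (trans (sum-tabulate size′ w woman (λ _ → refl)) (*-identityʳ w))
             (fold-concat-tabulate sum _+_ (λ _ _ → refl) sum-++ size′ r′ _ (λ i → n (3 + i) * (3 + i))
               (λ j → sum-tabulate size′ (n (3 + toℕ j)) (polygamous j) (λ i → cong suc (wives# (family (3 + toℕ j) _ _ i))))))
             (trans (sum-tabulate size′ m man (λ _ → refl)) (*-identityʳ m))) ⟩
    n 2 * 2 + (w + T + m)  ≡⟨ ring (n 2 * 2) w T m ⟩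
    n 2 * 2 + T + m + w    ∎
    where
    open ≡-Reasoning
    size′ : Group → ℕ
    size′ = length ∘ members
    S : List Group → ℕ
    S = sum ∘ map size′
    T = sum (applyUpTo (λ i → n (3 + i) * (3 + i)) r′)
    split : ∀ gs hs → S (gs ++ hs) ≡ S gs + S hs
    split gs hs = trans (cong sum (map-++ size′ gs hs)) (sum-++ (map size′ gs) _)
    wives# : ∀ f → length (wivesOf f) ≡ wives f
    wives# f = trans (length-map (wife f) (allFin (wives f))) (length-tabulate {n = wives f} id)
    ring : ∀ x y z u → x + (y + z + u) ≡ x + z + u + y
    ring = solve-∀

-- Seats of the table

∸-< : ∀ {k l d} → k ≤ d → d < k + l → d ∸ k < l
∸-< {k} {l} {d} k≤d d< = +-cancelˡ-< k (d ∸ k) l (subst (_< k + l) (sym (m+[n∸m]≡n k≤d)) d<)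

toℕ-⊕-< : ∀ (i : Fin N) d → toℕ i + d < N → toℕ (i ⊕ d) ≡ toℕ i + d
toℕ-⊕-< i d lt = trans (toℕ-⊕ i d) (m<n⇒m%n≡m lt)
  where instance _ = nonZeroIndex i

toℕ-⊕-≡ : ∀ (i : Fin N) d → toℕ i + d ≡ N → toℕ (i ⊕ d) ≡ 0
toℕ-⊕-≡ {N} i d eq = trans (toℕ-⊕ i d) (trans (cong (_% N) eq) (n%n≡0 N))
  where instance _ = nonZeroIndex i

⊕-identityʳ : ∀ (i : Fin N) → i ⊕ 0 ≡ i
⊕-identityʳ i = ⊕-full i 0

⊕-comm : ∀ (i j : Fin N) → i ⊕ toℕ j ≡ j ⊕ toℕ i
⊕-comm {N} i j = toℕ-injective (trans (toℕ-⊕ i (toℕ j))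
  (trans (cong (_% N) (+-comm (toℕ i) (toℕ j))) (sym (toℕ-⊕ j (toℕ i)))))
  where instance _ = nonZeroIndex i

⊕-swap : ∀ (i : Fin N) d e → i ⊕ d ⊕ e ≡ i ⊕ e ⊕ d
⊕-swap i d e = trans (⊕-⊕ i d e) (trans (cong (i ⊕_) (+-comm d e)) (sym (⊕-⊕ i e d)))

⊕-cancelʳ : ∀ {i j : Fin N} d → i ⊕ d ≡ j ⊕ d → i ≡ j
⊕-cancelʳ {N} {i} {j} d eq = trans (sym (⊕-back i d)) (trans (⊕-swap i _ d)
  (trans (cong (_⊕ d * pred N) eq) (trans (⊕-swap j d _) (⊕-back j d))))

⊕-cancelˡ : ∀ (i : Fin N) {d e} → d < N → e < N → i ⊕ d ≡ i ⊕ e → d ≡ e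
⊕-cancelˡ i {d} {e} d<N e<N eq = trans (sym (toℕ-fromℕ< d<N)) (trans (cong toℕ
  (⊕-cancelʳ (toℕ i) (trans (as-seat d<N) (trans eq (sym (as-seat e<N)))))) (toℕ-fromℕ< e<N))
  where
  as-seat : ∀ {d} (d<N : d < _) → fromℕ< d<N ⊕ toℕ i ≡ i ⊕ d
  as-seat d<N = trans (⊕-comm (fromℕ< d<N) i) (cong (i ⊕_) (toℕ-fromℕ< d<N))

⊕-surjective : ∀ (i j : Fin N) → ∃ λ d → d < N × i ⊕ d ≡ j
⊕-surjective {N} i j = toℕ k , toℕ<n k , trans (⊕-comm i k) (⊕-back j (toℕ i))
  where k = j ⊕ toℕ i * pred N

⊕-fixed : ∀ {i : Fin N} {d} → i ⊕ d ≡ i → ∀ j → j ⊕ d ≡ j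
⊕-fixed {i = i} {d} eq j with e , _ , refl ← ⊕-surjective i j = trans (⊕-swap i e d) (cong (_⊕ e) eq)

Consecutive-resp : {P Q : Pred (Fin N) 0ℓ} → (∀ {i} → P i → Q i) → (∀ {i} → Q i → P i) →
  Consecutive P → Consecutive Q
Consecutive-resp f g (a , l , h) = a , l , λ x → mk⇔ (Equivalence.to (h x) ∘ g) (f ∘ Equivalence.from (h x))

module _ {P : Pred A 0ℓ} where

  interval-run : ∀ (g : ℕ → A) N l → (∀ {d} → d < N → P (g d) → d < l) →
    (∀ {d} → d < l → P (g d)) → Run P (applyUpTo g N)
  interval-run g zero    l       to from = stop []
  interval-run g (suc N) zero    to from =
    stop (All.applyUpTo⁺₁ g (suc N) λ lt p → contradiction (to lt p) λ ())
  interval-run g (suc N) (suc l) to from = from (s≤s z≤n) ∷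
    interval-run (g ∘ suc) N l (λ lt p → ≤-pred (to (s≤s lt) p)) (λ lt → from (s≤s lt))

  interval-contiguous : ∀ (g : ℕ → A) N k l → (∀ {d} → d < N → P (g d) → k ≤ d × d < k + l) →
    (∀ {d} → k ≤ d → d < k + l → P (g d)) → Contiguous P (applyUpTo g N)
  interval-contiguous g N       zero    l to from =
    start (interval-run g N l (λ lt p → proj₂ (to lt p)) (from z≤n))
  interval-contiguous g zero    (suc k) l to from = start (stop [])
  interval-contiguous g (suc N) (suc k) l to from =
    (λ p → contradiction (proj₁ (to (s≤s z≤n) p)) λ ()) ∷
    interval-contiguous (g ∘ suc) N k l
      (λ lt p → ≤-pred (proj₁ (to (s≤s lt) p)) , ≤-pred (proj₂ (to (s≤s lt) p)))
      (λ k≤ <k+l → from (s≤s k≤) (s≤s <k+l))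

  -- Read from a seat outside it, a cyclic interval does not wrap around.

  consecutive⇒contiguous : ∀ {s : Fin N → A} a → ¬ P (s a) → Consecutive (P ∘ s) →
    Contiguous P (applyUpTo (λ d → s (a ⊕ d)) N)
  consecutive⇒contiguous {N} {s} a ¬Pa (b , l , h) with e , e<N , refl ← ⊕-surjective a b =
    interval-contiguous (λ d → s (a ⊕ d)) N e l to from
    where
    bound : ∀ {j} → j < l → e + j < N
    bound {j} j<l with e + j <? N
    ... | yes lt = lt
    -- An interval reaching offset `N` would pass through the seat `a` itself, at its own offset
    -- `N ∸ e`.
    ... | no ge = contradiction (Equivalence.from (h a) (N ∸ e ,
          ≤-<-trans (m≤n+o⇒m∸n≤o N e (≮⇒≥ ge)) j<l ,
          sym (trans (⊕-⊕ a e (N ∸ e)) (trans (cong (a ⊕_) (trans (m+[n∸m]≡n (<⇒≤ e<N)) (sym (*-identityˡ N)))) (⊕-full a 1))))) ¬Pa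
    to : ∀ {d} → d < N → P (s (a ⊕ d)) → e ≤ d × d < e + l
    to {d} d<N p with j , j<l , eq ← Equivalence.to (h (a ⊕ d)) p
                 with refl ← ⊕-cancelˡ a d<N (bound j<l) (trans eq (⊕-⊕ a e j)) =
      m≤m+n e j , +-monoʳ-< e j<l
    from : ∀ {d} → e ≤ d → d < e + l → P (s (a ⊕ d))
    from {d} e≤d d<e+l = Equivalence.from (h (a ⊕ d)) (d ∸ e ,
      ∸-< e≤d d<e+l ,
      sym (trans (⊕-⊕ a e (d ∸ e)) (cong (a ⊕_) (m+[n∸m]≡n e≤d))))

  run-interval : ∀ {xs} → Run P xs → ∃ λ l → l ≤ length xs ×
    (∀ i → P (lookup xs i) → toℕ i < l) × (∀ i → toℕ i < l → P (lookup xs i))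
  run-interval (stop out) = 0 , z≤n , (λ i p → contradiction p (All.lookup out (∈-lookup i))) , λ _ ()
  run-interval (p ∷ ρ) with l , l≤ , to , from ← run-interval ρ = suc l , s≤s l≤ ,
    (λ { zero _ → s≤s z≤n ; (suc i) q → s≤s (to i q) }) ,
    (λ { zero _ → p ; (suc i) (s≤s lt) → from i lt })

  contiguous-interval : ∀ {xs} → Contiguous P xs → ∃ λ k → ∃ λ l → k + l ≤ length xs ×
    (∀ i → P (lookup xs i) → k ≤ toℕ i × toℕ i < k + l) ×
    (∀ i → k ≤ toℕ i → toℕ i < k + l → P (lookup xs i))
  contiguous-interval (start ρ) with l , l≤ , to , from ← run-interval ρ =
    0 , l , l≤ , (λ i p → z≤n , to i p) , (λ i _ → from i)
  contiguous-interval (¬p ∷ c) with k , l , l≤ , to , from ← contiguous-interval c =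
    suc k , l , s≤s l≤ ,
    (λ { zero p → contradiction p ¬p ; (suc i) p → let a , b = to i p in s≤s a , s≤s b }) ,
    (λ { (suc i) (s≤s a) (s≤s b) → from i a b })

  contiguous⇒consecutive : ∀ {xs} → Contiguous P xs → Fin (length xs) → Consecutive (P ∘ lookup xs)
  contiguous⇒consecutive {xs} c z with contiguous-interval c
  -- The set is empty; any seat can start an interval of length 0, and `z` supplies one.
  ... | k , zero , k≤ , to , from = z , 0 , λ x → mk⇔
    (λ p → let a , b = to x p in contradiction (≤-trans b (≤-reflexive (+-identityʳ k))) (≤⇒≯ a))
    (λ { (_ , () , _) })
  ... | k , suc l , k+l≤ , to , from = a , suc l , λ x → mk⇔
    (λ p → let k≤ , lt = to x p
               j< = ∸-< k≤ lt
           in toℕ x ∸ k , j< , toℕ-injective (sym (trans (a⊕ j<) (m+[n∸m]≡n k≤))))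
    (λ { (j , j< , refl) → from (a ⊕ j) (≤-trans (m≤m+n k j) (≤-reflexive (sym (a⊕ j<))))
                             (≤-trans (s≤s (≤-reflexive (a⊕ j<))) (+-monoʳ-< k j<)) })
    where
    k<N : k < length xs
    k<N = ≤-trans (≤-trans (s≤s (m≤m+n k l)) (≤-reflexive (sym (+-suc k l)))) k+l≤
    a = fromℕ< k<N
    a⊕ : ∀ {j} → j < suc l → toℕ (a ⊕ j) ≡ k + j
    a⊕ {j} j< = trans (toℕ-⊕-< a j (subst (λ i → i + j < length xs) (sym (toℕ-fromℕ< k<N))
                         (≤-trans (+-monoʳ-< k j<) k+l≤))) (cong (_+ j) (toℕ-fromℕ< k<N))

module _ {R : Rel A 0ℓ} where

  linked-lookup : ∀ {y} xs → Linked R (xs ++ y ∷ []) → ∀ i →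
    (∀ j → toℕ j ≡ suc (toℕ i) → R (lookup xs i) (lookup xs j)) ×
    (suc (toℕ i) ≡ length xs → R (lookup xs i) y)
  linked-lookup (x ∷ [])      (r ∷ l) zero    = (λ { zero () ; (suc ()) }) , λ _ → r
  linked-lookup (x ∷ x′ ∷ xs) (r ∷ l) zero    = (λ { zero () ; (suc zero) _ → r ; (suc (suc _)) () }) , λ ()
  linked-lookup (x ∷ x′ ∷ xs) (r ∷ l) (suc i) =
    (λ { zero () ; (suc j) eq → proj₁ (linked-lookup (x′ ∷ xs) l i) j (suc-injective eq) }) ,
    (λ eq → proj₂ (linked-lookup (x′ ∷ xs) l i) (suc-injective eq))

  -- Repeating the head at the end encodes the cycle: the successor of the last seat is seat `zero`,
  -- occupied by `y`.
  linked-⊕ : ∀ {y xs} → Linked R (y ∷ xs ++ y ∷ []) → ∀ i → R (lookup (y ∷ xs) i) (lookup (y ∷ xs) (i ⊕ 1))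
  linked-⊕ {y} {xs} l i with m≤n⇒m<n∨m≡n (toℕ<n i)
  ... | inj₁ lt = proj₁ (linked-lookup (y ∷ xs) l i) (i ⊕ 1)
                    (trans (toℕ-⊕-< i 1 (subst (_< suc (length xs)) (+-comm 1 (toℕ i)) lt)) (+-comm (toℕ i) 1))
  ... | inj₂ eq = subst (λ j → R (lookup (y ∷ xs) i) (lookup (y ∷ xs) j))
                    (sym (toℕ-injective {j = zero} (toℕ-⊕-≡ i 1 (trans (+-comm (toℕ i) 1) eq))))
                    (proj₂ (linked-lookup (y ∷ xs) l i) eq)

seat : (xs : List A) → length xs ≡ N → Fin N → A
seat xs refl = lookup xs

tabulate-seat : ∀ (xs : List A) (eq : length xs ≡ N) → tabulate (seat xs eq) ≡ xs
tabulate-seat xs refl = tabulate-lookup xs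

seat-applyUpTo : ∀ {xs : List A} {M} (eq : length xs ≡ M) (g : ℕ → A) N → xs ≡ applyUpTo g N →
  ∀ i → seat xs eq i ≡ g (toℕ i)
seat-applyUpTo refl g N refl = lookup-applyUpTo g N

seat-start : ∀ {x y : A} {xs} (eq : length (x ∷ y ∷ xs) ≡ N) → ∃ λ i → toℕ i ≡ 0 ×
  seat (x ∷ y ∷ xs) eq i ≡ x × seat (x ∷ y ∷ xs) eq (i ⊕ 1) ≡ y
seat-start {x = x} {y} {xs} refl = zero , refl , refl , cong (lookup (x ∷ y ∷ xs))
  (toℕ-injective {j = suc zero} (toℕ-⊕-< {suc (suc (length xs))} zero 1 (s≤s (s≤s z≤n))))

module _ {xs : List A} (U : Unique xs) (complete : ∀ x → x ∈ xs) where

  seatOf : length xs ≡ N → A → Fin N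
  seatOf refl x = Any.index (complete x)

  seat-seatOf : ∀ (eq : length xs ≡ N) x → seat xs eq (seatOf eq x) ≡ x
  seat-seatOf refl x = sym (lookup-index (complete x))

  seatOf-seat : ∀ (eq : length xs ≡ N) i → seatOf eq (seat xs eq i) ≡ i
  seatOf-seat refl i = lookup-injective U (sym (lookup-index (complete (lookup xs i))))

  seat-bijection : length xs ≡ N → Fin N ↔ A
  seat-bijection eq = mk↔ₛ′ (seat xs eq) (seatOf eq) (seat-seatOf eq) (seatOf-seat eq)

seat-⊕ : ∀ {R : Rel A 0ℓ} {y xs} → Linked R (y ∷ xs ++ y ∷ []) → (eq : length (y ∷ xs) ≡ N) →
  ∀ i → R (seat (y ∷ xs) eq i) (seat (y ∷ xs) eq (i ⊕ 1))
seat-⊕ l refl = linked-⊕ l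

seat-consecutive : ∀ {P : Pred A 0ℓ} {xs} → Contiguous P xs → (eq : length xs ≡ N) → Fin N →
  Consecutive (P ∘ seat xs eq)
seat-consecutive c refl = contiguous⇒consecutive c

module _ (S : Setoid 0ℓ 0ℓ) {C : Set} where

  private
    module S = Setoid S

  -- That `g` respects the equivalence follows from injectivity of `f`, so a code may be read from a
  -- seating by any choice of starting seat.
  hasCardinality : ∀ {k} (f : C → S.Carrier) (g : S.Carrier → C) →
    (∀ c d → f c S.≈ f d → c ≡ d) → (∀ s → f (g s) S.≈ s) → C ↔ Fin k → HasCardinality S k
  hasCardinality f g f-injective fg size = record
    { to        = Inverse.to size ∘ g
    ; from      = f ∘ Inverse.from size
    ; to-cong   = λ {s} {t} s≈t → cong (Inverse.to size)
        (f-injective _ _ (S.trans (fg s) (S.trans s≈t (S.sym (fg t)))))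
    ; from-cong = λ { refl → S.refl }
    ; inverse   = (λ {i} {s} s≈ → trans (cong (Inverse.to size) (f-injective _ _ (S.trans (fg s) s≈)))
                                        (Inverse.strictlyInverseˡ size i))
                , (λ { {s} refl → S.trans (S.reflexive (cong f (Inverse.strictlyInverseʳ size (g s)))) (fg s) })
    }

-- This is where the evenness of the number of couples enters.
others-double : ∀ s q → others s (double q) ≡ s
others-double s zero    = refl
others-double s (suc q) = trans (cong (λ t → others t (double q)) (other-involutive s)) (others-double s q)

rotation-sym : ∀ {A : Set} {s t : Fin N → A} → RotationOf s t → RotationOf t s
rotation-sym {s = s} {t} = IsEquivalence.sym rotationOf-isEquivalence {s} {t}

allFin-∷ : ∀ k → 0 < k → ∃ λ c → ∃ λ cs → allFin k ≡ c ∷ cs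
allFin-∷ (suc k) _ = zero , tabulate suc , refl

Σ-Sex : ∀ {B : Sex → Set} {k} → (∀ s → B s ↔ Fin k) → Σ Sex B ↔ Fin (2 * k)
Σ-Sex {B} {k} f = resize (cong (k +_) (sym (+-identityʳ k)))
  (↔-trans (mk↔ₛ′ to from to-from from-to) (⊎-size (f ♂) (f ♀)))
  where
  to : Σ Sex B → B ♂ ⊎ B ♀
  to (♂ , b) = inj₁ b
  to (♀ , b) = inj₂ b
  from : B ♂ ⊎ B ♀ → Σ Sex B
  from (inj₁ b) = ♂ , b
  from (inj₂ b) = ♀ , b
  to-from : ∀ b → to (from b) ≡ b
  to-from (inj₁ _) = refl
  to-from (inj₂ _) = refl
  from-to : ∀ b → from (to b) ≡ b
  from-to (♂ , _) = refl
  from-to (♀ , _) = refl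

-- Seatings up to rotation and their codes.

module Main (r′ : ℕ) (n : ℕ → ℕ) (m w : ℕ) (q : ℕ) (even : n 2 ≡ suc q * 2) where

  open Everyone r′ n m w

  private
    r : ℕ
    r = 2 + r′
    seats : ℕ
    seats = persons r n m w

  open Rounds r n m w 2≤r
  open Counting r n m w 2≤r
  open Seating

  module _ (c₀ : Fin (n 2)) (cs₀ : List (Fin (n 2))) (split : allFin (n 2) ≡ c₀ ∷ cs₀) where

    length-couples : suc (length cs₀) ≡ double (suc q)
    length-couples = trans (cong length (sym split))
      (trans (length-tabulate {n = n 2} id) (trans even (sym (double-* (suc q)))))

    -- The table is read from the couple c₀ on, starting with its spouse of sex t.

    Code : Set
    Code = Σ Sex λ t → Line (other t) cs₀ (items (other t)) (items t)

    -- After the husband of `c₀` the line continues with women, after the wife with men;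
    -- `lines-comm` makes the two counts literally equal, hence the factor 2.
    Code-size : Code ↔ Fin (2 * (weight (items ♀) * lines (suc (double q)) m (w + Σ[ 3 ⋯ r ] n)))
    Code-size = Σ-Sex λ
      { ♂ → resize (trans (cong₂ (λ x y → weight (items ♀) * x * y) weight-items-♂
               (trans (cong₂ (lines D) length-items-♀ length-items-♂) (lines-comm q _ m)))
               (cong (_* lines D m (w + Σ[ 3 ⋯ r ] n)) (*-identityʳ (weight (items ♀)))))
             (Line-size D (length (items ♀)) cs₀ (items ♀) (items ♂) len refl)
      ; ♀ → resize (trans (cong₂ (λ x y → x * weight (items ♀) * y) weight-items-♂
               (cong₂ (lines D) length-items-♂ length-items-♀))
               (cong (_* lines D m (w + Σ[ 3 ⋯ r ] n)) (*-identityˡ (weight (items ♀)))))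
             (Line-size D (length (items ♂)) cs₀ (items ♂) (items ♀) len refl)
      }
      where
      D = suc (double q)
      len : length cs₀ ≡ D
      len = suc-injective length-couples

    -- Prefixing `c₀` as a turn makes the whole circle a line, so the facts about lines apply to it.
    round : ((t , _) : Code) → Line t (c₀ ∷ cs₀) (items t) (items (other t))
    round (t , ℓ) = turn zero ℓ

    groups-split : ∀ t → allGroups t ≡ groups (c₀ ∷ cs₀) (items t) (items (other t))
    groups-split t = cong (λ cs → groups cs (items t) (items (other t))) split

    round-groups-Unique : ∀ t → Unique (groups (c₀ ∷ cs₀) (items t) (items (other t)))
    round-groups-Unique t = subst Unique (groups-split t) (allGroups-Unique t)

    round-↭ : ∀ c → people (round c) ↭ everyone (proj₁ c)
    round-↭ c@(t , _) = ↭-trans (people-↭ (round c)) (↭-reflexive (cong (concatMap members) (sym (groups-split t))))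

    round-length : ∀ c → length (people (round c)) ≡ seats
    round-length c@(t , _) = trans (↭-length (round-↭ c)) (length-everyone t)

    -- After an even number of couples the expected sex is `t` again, that of the first person, so
    -- the circle closes. The calm predecessor that `people-follows` asks for is supplied
    -- artificially and dropped.
    round-linked : ∀ c → Linked Compatible (people (round c) ++ spouse (proj₁ c) c₀ ∷ [])
    round-linked c@(t , _) = Linked-tail (people-follows (items-sexed t) (items-sexed (other t)) (round c)
      (λ {p} calm → calm-compatible (subst (λ s → Calm s p)
         (trans (cong (others t) length-couples) (others-double t (suc q))) calm) (spouse-calm t c₀) ∷ [-])
      (spouse-calm t c₀))

    ∈Family⇒InGroup : ∀ {p f} → p ∈Family f → InGroup (fam f) p
    ∈Family⇒InGroup (husband f) = refl
    ∈Family⇒InGroup (wife f j)  = refl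

    InGroup⇒∈Family : ∀ p {f} → InGroup (fam f) p → p ∈Family f
    InGroup⇒∈Family (husband f) refl = husband f
    InGroup⇒∈Family (wife f j)  refl = wife f j

    round-start : ∀ c → ∃ λ i → toℕ i ≡ 0 ×
      seat (people (round c)) (round-length c) i ≡ spouse (proj₁ c) c₀ ×
      seat (people (round c)) (round-length c) (i ⊕ 1) ≡ spouse (other (proj₁ c)) c₀
    round-start c@(t , ℓ) = seat-start {x = spouse t c₀} {spouse (other t) c₀} {people ℓ} (round-length c)

    toSeating : Code → Seating r n m w
    toSeating c@(t , _) = record
      { bijection            = seat-bijection (Unique-resp-↭ (↭-sym (round-↭ c)) (everyone-Unique t))
                                 (λ p → ∈-resp-↭ (↭-sym (round-↭ c)) (∈-everyone t p)) eq
      ; familiesTogether     = λ f → Consecutive-resp (InGroup⇒∈Family _) ∈Family⇒InGroup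
          (seat-consecutive (people-contiguous (round-groups-Unique t) (round c) (fam f)) eq
            (proj₁ (round-start c)))
      ; onlyOwnWivesAdjacent = λ x y adj → proj₁ (proj₁ (adjacent adj))
      ; husbandsSurrounded   = λ f 1< x y e adj → proj₂ (proj₁ (adjacent adj)) f 1< e
      }
      where
      eq = round-length c
      adjacent : ∀ {x y} → Adjacent x y → Compatible (seat (people (round c)) eq x) (seat (people (round c)) eq y)
      adjacent (inj₁ refl) = seat-⊕ (round-linked c) eq _
      adjacent (inj₂ refl) = compatible-sym (seat-⊕ (round-linked c) eq _)

    3≤seats : 3 ≤ seats
    3≤seats = ≤-trans (≤-trans (≤-trans (subst (λ k → 3 ≤ k * 2) (sym even) (s≤s (s≤s (s≤s z≤n))))
                    (m≤m+n (n 2 * 2) _)) (m≤m+n _ m)) (m≤m+n _ w)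

    2≤seats : ∃ λ k → seats ≡ 2 + k
    2≤seats = seats ∸ 2 , sym (m+[n∸m]≡n (≤-trans (s≤s (s≤s z≤n)) 3≤seats))

    spouses-of : ∀ {c p p′} → p ∈Family couple c → p′ ∈Family couple c → p ≢ p′ →
      ∃ λ t → p ≡ spouse t c × p′ ≡ spouse (other t) c
    spouses-of (husband _)   (husband _)   ne = contradiction refl ne
    spouses-of (husband _)   (wife _ zero) ne = ♂ , refl , refl
    spouses-of (wife _ zero) (husband _)   ne = ♀ , refl , refl
    spouses-of (wife _ zero) (wife _ zero) ne = contradiction refl ne

    module _ (s : Seating r n m w) where

      occupant-injective : ∀ {i j} → occupant s i ≡ occupant s j → i ≡ j
      occupant-injective {i} {j} e = trans (sym (Inverse.strictlyInverseʳ (bijection s) i))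
        (trans (cong (Inverse.from (bijection s)) e) (Inverse.strictlyInverseʳ (bijection s) j))

      occupant-surjective : ∀ p → ∃ λ i → occupant s i ≡ p
      occupant-surjective p = _ , Inverse.strictlyInverseˡ (bijection s) p

      neighbours-compatible : ∀ i → Compatible (occupant s i) (occupant s (i ⊕ 1))
      neighbours-compatible i =
        (onlyOwnWivesAdjacent s _ _ (inj₁ refl) , λ f 1< e → husbandsSurrounded s f 1< _ _ e (inj₁ refl)) ,
        (onlyOwnWivesAdjacent s _ _ (inj₂ refl) , λ f 1< e → husbandsSurrounded s f 1< _ _ e (inj₂ refl))

      -- The interval of the couple `c₀` starts at `a`. The spouses sit at different offsets, so its
      -- length exceeds 1 and `a ⊕ 1` also belongs to the couple.
      anchor : ∃ λ a → ∃ λ t → occupant s a ≡ spouse t c₀ × occupant s (a ⊕ 1) ≡ spouse (other t) c₀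
      anchor with a , l , h ← familiesTogether s (couple c₀) = a , result
        where
        seated : ∀ p → p ∈Family couple c₀ → ∃ λ j → j < l × occupant s (a ⊕ j) ≡ p
        seated p p∈ with i , refl ← occupant-surjective p with j , j<l , refl ← Equivalence.to (h i) p∈ =
          j , j<l , refl
        member : ∀ {j} → j < l → occupant s (a ⊕ j) ∈Family couple c₀
        member {j} j<l = Equivalence.from (h (a ⊕ j)) (j , j<l , refl)
        result : ∃ λ t → occupant s a ≡ spouse t c₀ × occupant s (a ⊕ 1) ≡ spouse (other t) c₀
        result with seated (spouse ♂ c₀) (husband _) | seated (spouse ♀ c₀) (wife _ zero)
        ... | j , j<l , e | j′ , j′<l , e′ =
          spouses-of (subst (λ i → occupant s i ∈Family couple c₀) (⊕-identityʳ a) (member (<⇒≤ 1<l)))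
            (member 1<l) a≢
          where
          differ : ¬ a ⊕ j ≡ a ⊕ j′
          differ eq with trans (sym e) (trans (cong (occupant s) eq) e′)
          ... | ()
          later<l : ∀ j j′ → j < l → j′ < l → ¬ a ⊕ j ≡ a ⊕ j′ → 1 < l
          later<l zero    zero     _   _    ne = contradiction refl ne
          later<l (suc j) _        j<l _    ne = ≤-trans (s≤s (s≤s z≤n)) j<l
          later<l zero    (suc j′) _   j′<l ne = ≤-trans (s≤s (s≤s z≤n)) j′<l
          1<l : 1 < l
          1<l = later<l j j′ j<l j′<l differ
          a≢ : occupant s a ≢ occupant s (a ⊕ 1)
          -- With equal occupants `a` and `a ⊕ 1` would be one seat, and then every offset from `a`
          -- would lead back to `a`.
          a≢ eq = differ (trans (stay j) (sym (stay j′)))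
            where
            stay : ∀ j → a ⊕ j ≡ a
            stay zero    = ⊕-identityʳ a
            stay (suc j) = trans (sym (⊕-⊕ a 1 j)) (trans (cong (_⊕ j) (sym (occupant-injective eq))) (stay j))

      readSeating : ∃ λ c → ∃ λ a → people (round c) ≡ applyUpTo (λ d → occupant s (a ⊕ d)) seats
      readSeating with a , t , e₀ , e₁ ← anchor | k , seats≡ ← 2≤seats = (t , proj₁ rest-line) , a ,
          trans (cong (λ u → spouse t c₀ ∷ spouse (other t) c₀ ∷ u) (proj₂ rest-line)) (sym L≡)
        where
        g : ℕ → Person r n m w
        g d = occupant s (a ⊕ d)
        L rest : List (Person r n m w)
        L = applyUpTo g seats
        rest = applyUpTo (g ∘ (2 +_)) k
        x y : Person r n m w
        x = spouse (other t) c₀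
        y = spouse t c₀
        gs : List Group
        gs = groups cs₀ (items (other t)) (items t)
        L≡ : L ≡ y ∷ x ∷ rest
        L≡ = trans (cong (applyUpTo g) seats≡)
                   (cong₂ (λ p p′ → p ∷ p′ ∷ rest) (trans (cong (occupant s) (⊕-identityʳ a)) e₀) e₁)
        ↭gs : allGroups t ↭ pair c₀ ∷ gs
        ↭gs = ↭-trans (↭-reflexive (groups-split t)) (groups-couple (c₀ ∷ cs₀) (items t) (items (other t)) zero)
        U : Unique (pair c₀ ∷ gs)
        U = Unique-resp-↭ ↭gs (allGroups-Unique t)
        L-Unique : Unique L
        L-Unique = AllPairs.applyUpTo⁺₁ g seats λ i<j j< e →
          <⇒≢ i<j (⊕-cancelˡ a (<-trans i<j j<) j< (occupant-injective e))
        ∈L : ∀ p → p ∈ L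
        ∈L p with i , refl ← occupant-surjective p with d , d< , refl ← ⊕-surjective a i = ∈-applyUpTo⁺ g d<
        L↭ : L ↭ everyone t
        L↭ = unique∧set⇒↭ L-Unique (everyone-Unique t) (λ {p} _ → ∈-everyone t p) (λ {p} _ → ∈L p)
        rest↭ : rest ↭ concatMap members gs
        rest↭ = drop-∷ (drop-∷ (↭-trans (↭-reflexive (sym L≡)) (↭-trans L↭
          (↭-trans (concatMap-↭ members ↭gs) (++⁺ʳ _ (↭-sym (spouses-↭ t c₀)))))))
        -- Reading `suc seats` offsets returns to the seat `a`, which puts a second copy of `y` at
        -- the end; the leading copy is dropped.
        linked : Linked Compatible (x ∷ rest ++ y ∷ [])
        linked = Linked-tail (subst (Linked Compatible)
          (trans (sym (applyUpTo-∷ʳ g seats)) (cong₂ (λ u p → u ++ p ∷ []) L≡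
            (trans (cong (occupant s) (trans (cong (a ⊕_) (sym (*-identityˡ seats))) (⊕-full a 1))) e₀)))
          (Linked.applyUpTo⁺₂ g (suc seats) λ d → subst (λ i → Compatible (g d) (occupant s i))
            (trans (⊕-⊕ a d 1) (cong (a ⊕_) (+-comm d 1))) (neighbours-compatible (a ⊕ d))))
        contiguous : ∀ f → Contiguous (InGroup (fam f)) rest
        -- The couple `c₀` is used up by the first two seats; any other family avoids the seat `a`,
        -- so its interval does not wrap.
        contiguous f with pair c₀ ≟ᴳ fam f
        ... | yes eq = start (stop (subst (λ h → All (∁ (InGroup h)) rest) eq (outside U rest↭)))
        ... | no ne  = Contiguous-tail (Contiguous-tail (subst (Contiguous _) L≡
          (consecutive⇒contiguous a (λ eq → ne (trans (sym (trans (cong groupOf e₀) (spouse-group t c₀))) eq))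
            (Consecutive-resp ∈Family⇒InGroup (InGroup⇒∈Family _) (familiesTogether s f)))))
        rest-line : ∃ λ (ℓ : Line (other t) cs₀ (items (other t)) (items t)) → people ℓ ≡ rest
        rest-line = read-line (length rest) rest ≤-refl (items-sexed (other t))
          (subst (λ u → Sexed u (items t)) (sym (other-involutive t)) (items-sexed t))
          (spouse-calm (other t) c₀) (subst (λ h → Unique (h ∷ gs)) (sym (spouse-group (other t) c₀)) U)
          (subst (λ h → All (h ≢_) _) (sym (spouse-group t c₀)) (All.++⁻ʳ (map pair cs₀) (AllPairs.head U)))
          rest↭ linked contiguous

    toSeating-surjective : ∀ s → RotationOf (occupant (toSeating (proj₁ (readSeating s)))) (occupant s)
    toSeating-surjective s = rotation-sym {s = occupant s} (toℕ a , λ i →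
      trans (seat-applyUpTo (round-length c) _ seats eq i) (cong (occupant s) (⊕-comm a i)))
      where
      c = proj₁ (readSeating s)
      a = proj₁ (proj₂ (readSeating s))
      eq = proj₂ (proj₂ (readSeating s))

    -- Both seatings have the same spouse of `c₀` in the first seat, so the rotation fixes that seat
    -- and therefore every seat.
    same-sex : ∀ t ℓ ℓ′ → RotationOf (occupant (toSeating (t , ℓ))) (occupant (toSeating (t , ℓ′))) → ℓ ≡ ℓ′
    same-sex t ℓ ℓ′ (d , h) = unturn (people-injective (round-groups-Unique t) (round c) (round c′) (begin
        people (round c)   ≡⟨ tabulate-seat _ (round-length c) ⟨
        tabulate o         ≡⟨ tabulate-cong (λ j → trans (h j) (cong o (fixed j))) ⟨
        tabulate o′        ≡⟨ tabulate-seat _ (round-length c′) ⟩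
        people (round c′)  ∎))
      where
      open ≡-Reasoning
      c c′ : Code
      c  = t , ℓ
      c′ = t , ℓ′
      o o′ : Fin seats → Person r n m w
      o  = occupant (toSeating c)
      o′ = occupant (toSeating c′)
      i i′ : Fin seats
      i  = proj₁ (round-start c)
      i′ = proj₁ (round-start c′)
      i≡i′ : i ≡ i′
      i≡i′ = toℕ-injective (trans (proj₁ (proj₂ (round-start c))) (sym (proj₁ (proj₂ (round-start c′)))))
      fixed : ∀ j → j ⊕ d ≡ j
      fixed = ⊕-fixed (occupant-injective (toSeating c) (begin
        o (i ⊕ d)    ≡⟨ h i ⟨
        o′ i         ≡⟨ cong o′ i≡i′ ⟩
        o′ i′        ≡⟨ proj₁ (proj₂ (proj₂ (round-start c′))) ⟩
        spouse t c₀  ≡⟨ proj₁ (proj₂ (proj₂ (round-start c))) ⟨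
        o i          ∎))
      unturn : turn zero ℓ ≡ turn zero ℓ′ → ℓ ≡ ℓ′
      unturn refl = refl

    -- Such a rotation would move the first seat to the second and the second to the first, so a
    -- shift by 2 would be trivial; at least three seats exclude this.
    opposite-sex : ∀ t ℓ ℓ′ →
      ¬ RotationOf (occupant (toSeating (t , ℓ))) (occupant (toSeating (other t , ℓ′)))
    opposite-sex t ℓ ℓ′ (d , h) = contradiction (⊕-cancelˡ i 3≤seats (≤-trans (s≤s z≤n) 3≤seats) (begin
        i ⊕ 2      ≡⟨ ⊕-⊕ i 1 1 ⟨
        i ⊕ 1 ⊕ 1  ≡⟨ cong (_⊕ 1) forth ⟨
        i ⊕ d ⊕ 1  ≡⟨ ⊕-swap i d 1 ⟩
        i ⊕ 1 ⊕ d  ≡⟨ back ⟩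
        i          ≡⟨ ⊕-identityʳ i ⟨
        i ⊕ 0      ∎)) λ ()
      where
      open ≡-Reasoning
      c c′ : Code
      c  = t , ℓ
      c′ = other t , ℓ′
      o o′ : Fin seats → Person r n m w
      o  = occupant (toSeating c)
      o′ = occupant (toSeating c′)
      i i′ : Fin seats
      i  = proj₁ (round-start c)
      i′ = proj₁ (round-start c′)
      i≡i′ : i ≡ i′
      i≡i′ = toℕ-injective (trans (proj₁ (proj₂ (round-start c))) (sym (proj₁ (proj₂ (round-start c′)))))
      forth : i ⊕ d ≡ i ⊕ 1
      forth = occupant-injective (toSeating c) (begin
        o (i ⊕ d)            ≡⟨ h i ⟨
        o′ i                 ≡⟨ cong o′ i≡i′ ⟩
        o′ i′                ≡⟨ proj₁ (proj₂ (proj₂ (round-start c′))) ⟩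
        spouse (other t) c₀  ≡⟨ proj₂ (proj₂ (proj₂ (round-start c))) ⟨
        o (i ⊕ 1)            ∎)
      back : i ⊕ 1 ⊕ d ≡ i
      back = occupant-injective (toSeating c) (begin
        o (i ⊕ 1 ⊕ d)                ≡⟨ h (i ⊕ 1) ⟨
        o′ (i ⊕ 1)                   ≡⟨ cong (λ j → o′ (j ⊕ 1)) i≡i′ ⟩
        o′ (i′ ⊕ 1)                  ≡⟨ proj₂ (proj₂ (proj₂ (round-start c′))) ⟩
        spouse (other (other t)) c₀  ≡⟨ cong (λ u → spouse u c₀) (other-involutive t) ⟩
        spouse t c₀                  ≡⟨ proj₁ (proj₂ (proj₂ (round-start c))) ⟨
        o i                          ∎)

    toSeating-injective : ∀ c c′ → RotationOf (occupant (toSeating c)) (occupant (toSeating c′)) → c ≡ c′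
    toSeating-injective (♂ , ℓ) (♂ , ℓ′) ρ = cong (♂ ,_) (same-sex ♂ ℓ ℓ′ ρ)
    toSeating-injective (♂ , ℓ) (♀ , ℓ′) ρ = contradiction ρ (opposite-sex ♂ ℓ ℓ′)
    toSeating-injective (♀ , ℓ) (♂ , ℓ′) ρ = contradiction ρ (opposite-sex ♀ ℓ ℓ′)
    toSeating-injective (♀ , ℓ) (♀ , ℓ′) ρ = cong (♀ ,_) (same-sex ♀ ℓ ℓ′ ρ)

    seatings-size : HasCardinality (seatings r n m w)
      (2 * (weight (items ♀) * lines (suc (double q)) m (w + Σ[ 3 ⋯ r ] n)))
    seatings-size = hasCardinality (seatings r n m w) toSeating (proj₁ ∘ readSeating)
      toSeating-injective toSeating-surjective Code-size

  count-formula : 2 * (weight (items ♀) * lines (suc (double q)) m (w + Σ[ 3 ⋯ r ] n)) ≡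
      Π[ 3 ⋯ r ] (λ k → ((k ∸ 2) * (k ∸ 1) !) ^ n k)
    * (_/_ (n 2 !) ((n 2 / 2) !) {{(n 2 / 2) !≢0}})
    * (_/_ ((n 2 / 2 + m ∸ 1) !) ((n 2 / 2 ∸ 1) !) {{(n 2 / 2 ∸ 1) !≢0}})
    * (Σ[ 3 ⋯ r ] n + n 2 / 2 + w ∸ 1) !
  count-formula = begin
    2 * (weight (items ♀) * l)     ≡⟨ ring₁ (weight (items ♀)) l ⟩
    weight (items ♀) * (2 * l)     ≡⟨ cong₂ _*_ weight-items-♀ (lines-quotients q m (w + S) even) ⟩
    W * (X * Y * (w + S + q) !)    ≡⟨ ring₂ W X Y _ ⟩
    W * X * Y * (w + S + q) !      ≡⟨ cong (λ k → W * X * Y * k !) (sym exponent) ⟩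
    W * X * Y * (S + n 2 / 2 + w ∸ 1) !  ∎
    where
    open ≡-Reasoning
    S = Σ[ 3 ⋯ r ] n
    l = lines (suc (double q)) m (w + S)
    W = Π[ 3 ⋯ r ] (λ k → ((k ∸ 2) * (k ∸ 1) !) ^ n k)
    X = _/_ (n 2 !) ((n 2 / 2) !) {{(n 2 / 2) !≢0}}
    Y = _/_ ((n 2 / 2 + m ∸ 1) !) ((n 2 / 2 ∸ 1) !) {{(n 2 / 2 ∸ 1) !≢0}}
    ring₁ : ∀ x y → 2 * (x * y) ≡ x * (2 * y)
    ring₁ = solve-∀
    ring₂ : ∀ x y z u → x * (y * z * u) ≡ x * y * z * u
    ring₂ = solve-∀
    ring₃ : ∀ x y z → x + suc y + z ≡ suc (z + x + y)
    ring₃ = solve-∀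
    exponent : S + n 2 / 2 + w ∸ 1 ≡ w + S + q
    exponent = trans (cong (λ k → S + k + w ∸ 1) (trans (cong (_/ 2) even) (m*n/n≡m (suc q) 2)))
                     (cong (_∸ 1) (ring₃ S q w))

corollary1p2 : (r : ℕ) (n : ℕ → ℕ) (m w : ℕ) → 2 ≤ r → 2 ∣ n 2 → 2 ≤ n 2 →
    HasCardinality (seatings r n m w)
    ( Π[ 3 ⋯ r ] (λ k → ((k ∸ 2) * (k ∸ 1) !) ^ n k)
    * ((n 2 !) / ((n 2 / 2) !)) {{(n 2 / 2) !≢0}}
    * ((n 2 / 2 + m ∸ 1) ! / ((n 2 / 2 ∸ 1) !)) {{(n 2 / 2 ∸ 1) !≢0}}
    * (Σ[ 3 ⋯ r ] n + n 2 / 2 + w ∸ 1) ! )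
corollary1p2 (suc (suc r′)) n m w 2≤r (divides (suc q) even) 2≤n₂
  with c₀ , cs₀ , split ← allFin-∷ (n 2) (≤-trans (s≤s z≤n) 2≤n₂) =
  subst (HasCardinality (seatings (2 + r′) n m w)) (count-formula r′ n m w q even)
    (seatings-size r′ n m w q even c₀ cs₀ split)
  where
  open Main
corollary1p2 (suc (suc r′)) n m w 2≤r (divides zero even) 2≤n₂ =
  contradiction (subst (2 ≤_) even 2≤n₂) λ ()
corollary1p2 (suc zero) n m w (s≤s ()) _ _
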